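{- There is a positive absolute constant $\alpha$ such that the following holds. For any integers $k$ and $\ell$ with $2 \leq \ell < k$ and every sufficiently large integer $n$, \[ \max \left\{ 1 - \frac{\ell}{k},\; 1- \frac{4 \binom{\ell+2}{3}}{k(k+2)}\right\} \;\leq\; \mathbf{d}(Q_n, Q_\ell, Q_k) \;\leq\; \min \left\{ 1-\frac{\ell\, 2^{\ell}}{k\,2^k},\; 1- \alpha \frac{\log k}{k\,2^k}\right\}. \]
   Context: $Q_n$ denotes the $n$-dimensional hypercube: its vertices are the binary vectors of length $n$, two vectors being adjacent iff they differ in exactly one coordinate. For graphs $G$ and $T$, a copy of $T$ in $G$ is a subgraph of $G$ isomorphic to $T$, and $N(G,T)$ is the number of copies of $T$ in $G$. A graph is $H$-free if it has no subgraph isomorphic to $H$. For subgraphs $T,H$ of $G$, $\mathrm{ex}(G,T,H)=\max\{N(G',T): G'\subseteq G,\ G' \text{ is } H\text{ -free}\}$ and $\mathbf{d}(G,T,H)=\mathrm{ex}(G,T,H)/N(G,T)$. -}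

module Defs where

open import Data.Nat using (ℕ; zero; suc; _+_; _*_; _^_; _≤_; _≡ᵇ_)
open import Data.Nat.Properties using (≡ᵇ⇒≡; +-comm)
open import Data.Nat.Combinatorics using (_C_)
open import Data.Bool using (Bool; true; false; T)
open import Data.Vec using (Vec; []; _∷_)
open import Data.Fin using (Fin)
open import Data.Product using (Σ; ∃; _×_; _,_)
open import Relation.Nullary using (¬_)
open import Relation.Binary.PropositionalEquality using (_≡_; refl; cong₂; subst)

Vertex : ℕ → Set
Vertex n = Vec Bool n

diff : Bool → Bool → ℕ
diff true  true  = 0
diff false false = 0
diff true  false = 1
diff false true  = 1

diff-sym : ∀ a b → diff a b ≡ diff b a
diff-sym true  true  = refl
diff-sym true  false = refl
diff-sym false true  = refl
diff-sym false false = refl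

hamming : ∀ {n} → Vertex n → Vertex n → ℕ
hamming []      []      = 0
hamming (a ∷ u) (b ∷ v) = diff a b + hamming u v

hamming-sym : ∀ {n} (u v : Vertex n) → hamming u v ≡ hamming v u
hamming-sym []      []      = refl
hamming-sym (a ∷ u) (b ∷ v) = cong₂ _+_ (diff-sym a b) (hamming-sym u v)

adj : ∀ {n} → Vertex n → Vertex n → Bool
adj u v = hamming u v ≡ᵇ 1

Adj : ∀ {n} → Vertex n → Vertex n → Set
Adj u v = hamming u v ≡ 1

record Subgraph (n : ℕ) : Set where
  field
    V     : Vertex n → Bool
    E     : Vertex n → Vertex n → Bool
    E-sym : ∀ u v → E u v ≡ E v u
    E-adj : ∀ u v → E u v ≡ true → Adj u v
    E-V   : ∀ u v → E u v ≡ true → V u ≡ true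
open Subgraph public

Q : (n : ℕ) → Subgraph n
Q n = record
  { V     = λ _ → true
  ; E     = adj
  ; E-sym = λ u v → subst (λ t → (hamming u v ≡ᵇ 1) ≡ (t ≡ᵇ 1)) (hamming-sym u v) refl
  ; E-adj = λ u v e → ≡ᵇ⇒≡ (hamming u v) 1 (true⇒T e)
  ; E-V   = λ _ _ _ → refl
  }
  where
  true⇒T : ∀ {b} → b ≡ true → T b
  true⇒T refl = _

_≈_ : ∀ {n} → Subgraph n → Subgraph n → Set
G ≈ H = (∀ u → V G u ≡ V H u) × (∀ u v → E G u v ≡ E H u v)

_⊆_ : ∀ {n} → Subgraph n → Subgraph n → Set
H ⊆ G = (∀ u → V H u ≡ true → V G u ≡ true)
      × (∀ u v → E H u v ≡ true → E G u v ≡ true)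

IsoCube : ∀ {n} → ℕ → Subgraph n → Set
IsoCube {n} l H =
  Σ (Vertex l → Vertex n) λ f →
      (∀ x y → f x ≡ f y → x ≡ y)
    × (∀ x → V H (f x) ≡ true)
    × (∀ v → V H v ≡ true → ∃ λ x → f x ≡ v)
    × (∀ x y → E H (f x) (f y) ≡ adj x y)

CopyOf : ∀ {n} → ℕ → Subgraph n → Subgraph n → Set
CopyOf l G H = H ⊆ G × IsoCube l H

Free : ∀ {n} → ℕ → Subgraph n → Set
Free k G = ∀ H → H ⊆ G → ¬ IsoCube k H

HasCount : ∀ {n} → (Subgraph n → Set) → ℕ → Set
HasCount {n} P c =
  Σ (Fin c → Subgraph n) λ g →
      (∀ i → P (g i))
    × (∀ i j → g i ≈ g j → i ≡ j)
    × (∀ H → P H → ∃ λ i → H ≈ g i)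

NumCopies : ∀ {n} → ℕ → Subgraph n → ℕ → Set
NumCopies l G c = HasCount (CopyOf l G) c

IsEx : ℕ → ℕ → ℕ → ℕ → Set
IsEx n l k m =
    (Σ (Subgraph n) λ G → Free k G × NumCopies l G m)
  × (∀ (G : Subgraph n) c → Free k G → NumCopies l G c → c ≤ m)

{-# OPTIONS --safe #-}

-- Every copy of Q_l in Q_n is a subcube, so the problem is to decide how many
-- l-faces must lose an edge when every k-face does.
--
-- Upper bounds.  Each k-face has a missing edge, and an edge of Q_k lies in a
-- fraction l 2^l / (k 2^k) of its l-faces; double counting transfers this local
-- fraction to Q_n.  For the logarithmic bound, the endpoints of the edges missing
-- from a (k+2)-face must separate its k + 2 coordinates, so there are at least
-- log₂ (k + 2) of them; a random edge of a random l-face is a random edge, so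
-- the density of broken l-faces is at least the density of missing edges.
--
-- Lower bounds.  Colour the edges of Q_n so that every k-face sees all P colours
-- and every l-face at most w of them.  Deleting the colour class that breaks the
-- fewest l-faces breaks at most a fraction w / P.  Colouring by the number of ones
-- mod k has P = k and w = l.  Colouring by the numbers of ones to the left and to
-- the right of the edge's own coordinate, mod s and mod t with s + t = k + 1, has
-- P = s t and w = C(l+2, 3).
module Submission where

open import Defs
open import Data.Nat
open import Data.Nat.Properties
open import Data.Nat.Combinatorics using (_C_; nCk+nC[k+1]≡[n+1]C[k+1]; nC1≡n)
open import Data.Nat.DivMod using (_mod_; _%_; m<n⇒m%n≡m; [m+n]%n≡m%n)
open import Data.Nat.ListAction using (sum)
open import Data.Nat.ListAction.Properties using (sum-++)
open import Data.Nat.Tactic.RingSolver using (solve-∀)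
open import Data.Bool using (Bool; true; false; not; _∧_; if_then_else_; T)
import Data.Bool as Bool
open import Data.Bool.Properties using (not-involutive)
open import Data.Fin using (Fin; zero; suc; toℕ; punchIn; punchOut; combine; remQuot; funToFin; finToFun)
import Data.Fin as Fin
open import Data.Fin.Properties using (toℕ<n; toℕ-injective; toℕ-fromℕ<; combine-remQuot; punchIn-punchOut; finToFun-funToFin; injective⇒≤)
open import Data.List using (List; []; _∷_; _++_; map; filter; length; allFin; upTo; cartesianProductWith)
import Data.List as List
open import Data.List.Properties using (map-++; map-∘; map-cong; length-tabulate; length-map; length-upTo; length-++)
open import Data.List.Membership.Propositional using (_∈_)
open import Data.List.Membership.Propositional.Properties using (∈-map⁺; ∈-map⁻; ∈-++⁺ˡ; ∈-++⁺ʳ; ∈-++⁻; ∈-filter⁺; ∈-filter⁻; ∈-lookup; ∈-upTo⁺; ∈-cartesianProductWith⁺)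
open import Data.List.Relation.Unary.All using (All; []; _∷_)
import Data.List.Relation.Unary.All as All
open import Data.List.Relation.Unary.All.Properties using (¬All⇒Any¬)
open import Data.List.Relation.Unary.AllPairs using ([]; _∷_)
open import Data.List.Relation.Unary.Any using (here; there; index)
import Data.List.Relation.Unary.Any as Any
open import Data.List.Relation.Unary.Any.Properties using (lookup-index)
open import Data.List.Relation.Unary.Unique.Propositional using (Unique)
open import Data.List.Relation.Unary.Unique.Propositional.Properties using (map⁺; ++⁺; filter⁺; allFin⁺)
open import Data.Product using (∃; _×_; _,_; proj₁; proj₂)
import Data.Sum as Sum
open import Data.Sum using (_⊎_; inj₁; inj₂)
open import Data.Vec using (Vec; []; _∷_; lookup; tabulate; replicate; updateAt)
open import Data.Vec.Properties using (≡-dec; updateAt-updateAt; updateAt-id; updateAt-cong; lookup∘updateAt′; lookup∘tabulate)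
open import Function using (_∘_)
open import Relation.Binary.PropositionalEquality
open import Relation.Nullary using (yes; no; Dec; does; ¬_; ¬?; contradiction)
open import Relation.Nullary.Decidable using (dec-true; map′)
open import Relation.Unary using (Decidable)

private variable
  X Y : Set
  n k j l i P : ℕ

-- Sums over finite lists

sumOver : List X → (X → ℕ) → ℕ
sumOver xs f = sum (map f xs)

sumOver-cong : ∀ (xs : List X) {f g} → (∀ x → f x ≡ g x) → sumOver xs f ≡ sumOver xs g
sumOver-cong xs f≗g = cong sum (map-cong f≗g xs)

sumOver-mono : ∀ (xs : List X) {f g} → (∀ x → f x ≤ g x) → sumOver xs f ≤ sumOver xs g
sumOver-mono []       f≤g = z≤n
sumOver-mono (x ∷ xs) f≤g = +-mono-≤ (f≤g x) (sumOver-mono xs f≤g)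

sumOver-zero : ∀ (xs : List X) → sumOver xs (λ _ → 0) ≡ 0
sumOver-zero []       = refl
sumOver-zero (x ∷ xs) = sumOver-zero xs

interchange : ∀ a b c d → (a + b) + (c + d) ≡ (a + c) + (b + d)
interchange = solve-∀

sumOver-+ : ∀ (xs : List X) f g → sumOver xs (λ x → f x + g x) ≡ sumOver xs f + sumOver xs g
sumOver-+ []       f g = refl
sumOver-+ (x ∷ xs) f g = trans (cong (f x + g x +_) (sumOver-+ xs f g))
  (interchange (f x) (g x) (sumOver xs f) (sumOver xs g))

sumOver-*ˡ : ∀ a (xs : List X) f → sumOver xs (λ x → a * f x) ≡ a * sumOver xs f
sumOver-*ˡ a []       f = sym (*-zeroʳ a)
sumOver-*ˡ a (x ∷ xs) f = trans (cong (a * f x +_) (sumOver-*ˡ a xs f))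
  (sym (*-distribˡ-+ a (f x) (sumOver xs f)))

sumOver-++ : ∀ (xs ys : List X) f → sumOver (xs ++ ys) f ≡ sumOver xs f + sumOver ys f
sumOver-++ xs ys f = trans (cong sum (map-++ f xs ys)) (sum-++ (map f xs) (map f ys))

sumOver-map : ∀ (h : Y → X) xs f → sumOver (map h xs) f ≡ sumOver xs (f ∘ h)
sumOver-map h xs f = cong sum (sym (map-∘ xs))

sumOver-swap : ∀ (xs : List X) (ys : List Y) (f : X → Y → ℕ) →
  sumOver xs (λ x → sumOver ys (f x)) ≡ sumOver ys (λ y → sumOver xs (λ x → f x y))
sumOver-swap []       ys f = sym (sumOver-zero ys)
sumOver-swap (x ∷ xs) ys f = trans (cong (sumOver ys (f x) +_) (sumOver-swap xs ys f))
  (sym (sumOver-+ ys (f x) _))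

-- A face of Q_n of dimension l lists, coordinate by coordinate, whether it is
-- constant or runs over both values; there are l coordinates of the latter kind.
data Face : ℕ → ℕ → Set where
  point : Face 0 0
  fix   : Bool → Face n l → Face (suc n) l
  free  : Face n l → Face (suc n) (suc l)

infixr 9 _⊙_
-- The j free coordinates of `c` serve as the coordinates of Q_j, so that `d` becomes a subface of
-- `c`. Every l-face inside `c` arises in this way from exactly one `d`.
_⊙_ : Face n j → Face j l → Face n l
point   ⊙ d       = d
fix b c ⊙ d       = fix b (c ⊙ d)
free c  ⊙ fix b d = fix b (c ⊙ d)
free c  ⊙ free d  = free (c ⊙ d)

⊙-assoc : (c : Face n j) (d : Face j l) (e : Face l i) → (c ⊙ d) ⊙ e ≡ c ⊙ (d ⊙ e)
⊙-assoc point      d          e          = refl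
⊙-assoc (fix b c)  d          e          = cong (fix b) (⊙-assoc c d e)
⊙-assoc (free c)   (fix b d)  e          = cong (fix b) (⊙-assoc c d e)
⊙-assoc (free c)   (free d)   (fix b e)  = cong (fix b) (⊙-assoc c d e)
⊙-assoc (free c)   (free d)   (free e)   = cong free (⊙-assoc c d e)

faces : ∀ n l → List (Face n l)
faces zero    zero    = point ∷ []
faces zero    (suc l) = []
faces (suc n) zero    = map (fix true) (faces n zero) ++ map (fix false) (faces n zero)
faces (suc n) (suc l) =
  (map (fix true) (faces n (suc l)) ++ map (fix false) (faces n (suc l))) ++ map free (faces n l)

faces-empty : n < l → faces n l ≡ []
faces-empty {zero}  {suc l} _ = refl
faces-empty {suc n} {suc l} (s≤s n<l)
  rewrite faces-empty {n} {suc l} (m≤n⇒m≤1+n n<l) | faces-empty n<l = refl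

-- Sums over faces and double counting

opaque

  -- Opaque, so that a sum never unfolds into concatenated lists; later proofs use only the
  -- equations of this block.
  ∑ : (Face n l → ℕ) → ℕ
  ∑ {n} {l} = sumOver (faces n l)

  ∑-def : (g : Face n l → ℕ) → ∑ g ≡ sumOver (faces n l) g
  ∑-def g = refl

  ∑-point : (g : Face 0 0 → ℕ) → ∑ g ≡ g point
  ∑-point g = +-identityʳ (g point)

  ∑-vertex : (g : Face (suc n) 0 → ℕ) → ∑ g ≡ ∑ (g ∘ fix true) + ∑ (g ∘ fix false)
  ∑-vertex {n} g = trans (sumOver-++ (map (fix true) (faces n 0)) _ g)
    (cong₂ _+_ (sumOver-map (fix true) (faces n 0) g) (sumOver-map (fix false) (faces n 0) g))

  ∑-face : (g : Face (suc n) (suc l) → ℕ) →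
           ∑ g ≡ ∑ (g ∘ fix true) + ∑ (g ∘ fix false) + ∑ (g ∘ free)
  ∑-face {n} {l} g = trans (sumOver-++ (map (fix true) fs ++ map (fix false) fs) _ g)
    (cong₂ _+_
      (trans (sumOver-++ (map (fix true) fs) _ g)
        (cong₂ _+_ (sumOver-map (fix true) fs g) (sumOver-map (fix false) fs g)))
      (sumOver-map free (faces n l) g))
    where
    fs : List (Face n (suc l))
    fs = faces n (suc l)

  ∑-empty : n < l → (g : Face n l → ℕ) → ∑ g ≡ 0
  ∑-empty n<l g = cong (λ fs → sumOver fs g) (faces-empty n<l)

  ∑-cong : {f g : Face n l → ℕ} → (∀ c → f c ≡ g c) → ∑ f ≡ ∑ g
  ∑-cong {n} {l} = sumOver-cong (faces n l)

  ∑-mono : {f g : Face n l → ℕ} → (∀ c → f c ≤ g c) → ∑ f ≤ ∑ g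
  ∑-mono {n} {l} = sumOver-mono (faces n l)

  ∑-zero : ∀ n l → ∑ {n} {l} (λ _ → 0) ≡ 0
  ∑-zero n l = sumOver-zero (faces n l)

  ∑-+ : (f g : Face n l → ℕ) → ∑ (λ c → f c + g c) ≡ ∑ f + ∑ g
  ∑-+ {n} {l} = sumOver-+ (faces n l)

  ∑-*ˡ : ∀ a (f : Face n l → ℕ) → ∑ (λ c → a * f c) ≡ a * ∑ f
  ∑-*ˡ {n} {l} a = sumOver-*ˡ a (faces n l)

#faces : ℕ → ℕ → ℕ
#faces n l = ∑ {n} {l} (λ _ → 1)

-- The number of j-faces of Q_n that contain a given l-face, for l ≤ n.
#above : ℕ → ℕ → ℕ → ℕ
#above n       j       zero    = n C j
#above zero    j       (suc l) = 0
#above (suc n) zero    (suc l) = 0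
#above (suc n) (suc j) (suc l) = #above n j l

#above-zero : ∀ n l → #above n 0 (suc l) ≡ 0
#above-zero zero    l = refl
#above-zero (suc n) l = refl

pascal : ∀ n j → n C suc j + n C j ≡ suc n C suc j
pascal n j = trans (+-comm (n C suc j) (n C j)) (nCk+nC[k+1]≡[n+1]C[k+1] n j)

-- `#above n j l` counts the ways to free j - l of the n - l fixed coordinates of an l-face. This is
-- Pascal's rule: one chosen fixed coordinate stays fixed or is freed.
#above-pascal : l < n → #above n (suc j) (suc l) + #above n j (suc l) ≡ #above n j l
#above-pascal {zero}  {suc n} {zero}  _ = +-identityʳ 1
#above-pascal {zero}  {suc n} {suc j} _ = pascal n j
#above-pascal {suc l} {suc n} {zero}  (s≤s _) = trans (+-identityʳ _) (#above-zero n l)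
#above-pascal {suc l} {suc n} {suc j} (s≤s l<n) = #above-pascal {l} {n} {j} l<n

-- Each l-face is reached once from every j-face around it. The induction on n splits by the first
-- coordinate: fixed in `c`, free in `c` but fixed in `d`, or free in both.
double-count : ∀ n j l (g : Face n l → ℕ) →
  ∑ {n} {j} (λ c → ∑ {j} {l} (λ d → g (c ⊙ d))) ≡ #above n j l * ∑ g
double-count zero    zero    zero    g =
  trans (∑-point _) (trans (∑-cong λ _ → refl) (sym (+-identityʳ _)))
double-count zero    zero    (suc l) g = trans (∑-point _) (∑-empty z<s _)
double-count zero    (suc j) zero    g = ∑-empty z<s _
double-count zero    (suc j) (suc l) g = ∑-empty z<s _
double-count (suc n) zero    zero    g = trans (∑-vertex _)
  (trans (cong₂ _+_ (double-count n zero zero (g ∘ fix true)) (double-count n zero zero (g ∘ fix false)))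
    (trans (sym (*-distribˡ-+ 1 (∑ (g ∘ fix true)) (∑ (g ∘ fix false)))) (cong (1 *_) (sym (∑-vertex g)))))
double-count (suc n) zero    (suc l) g =
  trans (∑-cong λ _ → ∑-empty z<s _) (∑-zero (suc n) 0)
double-count (suc n) (suc j) zero    g = begin
  ∑ (λ c → ∑ (λ d → g (c ⊙ d)))
    ≡⟨ ∑-face _ ⟩
  S true + S false + ∑ (λ c → ∑ (λ d → g (free c ⊙ d)))
    ≡⟨ cong₂ _+_ (cong₂ _+_ (S≡ true) (S≡ false)) free≡ ⟩
  a * G true + a * G false + (b * G true + b * G false)
    ≡⟨ collect a b (G true) (G false) ⟩
  (a + b) * (G true + G false)
    ≡⟨ cong₂ _*_ (pascal n j) (sym (∑-vertex g)) ⟩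
  (suc n C suc j) * ∑ g ∎
  where
  open ≡-Reasoning
  a = n C suc j
  b = n C j
  S : Bool → ℕ
  S x = ∑ {n} {suc j} (λ c → ∑ {suc j} {0} (λ d → g (fix x (c ⊙ d))))
  G : Bool → ℕ
  G x = ∑ (g ∘ fix x)
  S≡ : ∀ x → S x ≡ a * G x
  S≡ x = double-count n (suc j) zero (g ∘ fix x)
  free≡ : ∑ {n} {j} (λ c → ∑ (λ d → g (free c ⊙ d))) ≡ b * G true + b * G false
  free≡ = trans (∑-cong (λ c → ∑-vertex _)) (trans (∑-+ _ _)
    (cong₂ _+_ (double-count n j zero (g ∘ fix true)) (double-count n j zero (g ∘ fix false))))
  collect : ∀ a b x y → a * x + a * y + (b * x + b * y) ≡ (a + b) * (x + y)
  collect = solve-∀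
double-count (suc n) (suc j) (suc l) g = begin
  ∑ (λ c → ∑ (λ d → g (c ⊙ d)))
    ≡⟨ ∑-face _ ⟩
  S true + S false + ∑ (λ c → ∑ (λ d → g (free c ⊙ d)))
    ≡⟨ cong₂ _+_ (cong₂ _+_ (S≡ true) (S≡ false)) free≡ ⟩
  a * G true + a * G false + (b * G true + b * G false + m * F)
    ≡⟨ collect a b m (G true) (G false) F ⟩
  (a + b) * G true + (a + b) * G false + m * F
    ≡⟨ cong (_+ m * F) (cong₂ _+_ (weight true) (weight false)) ⟩
  m * G true + m * G false + m * F
    ≡⟨ distr m (G true) (G false) F ⟨
  m * (G true + G false + F)
    ≡⟨ cong (m *_) (∑-face g) ⟨
  m * ∑ g ∎
  where
  open ≡-Reasoning
  a = #above n (suc j) (suc l)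
  b = #above n j (suc l)
  m = #above n j l
  S : Bool → ℕ
  S x = ∑ {n} {suc j} (λ c → ∑ {suc j} {suc l} (λ d → g (fix x (c ⊙ d))))
  G : Bool → ℕ
  G x = ∑ (g ∘ fix x)
  F : ℕ
  F = ∑ (g ∘ free)
  S≡ : ∀ x → S x ≡ a * G x
  S≡ x = double-count n (suc j) (suc l) (g ∘ fix x)
  free≡ : ∑ {n} {j} (λ c → ∑ (λ d → g (free c ⊙ d))) ≡ b * G true + b * G false + m * F
  free≡ = trans (∑-cong (λ c → ∑-face _)) (trans (∑-+ _ _)
    (cong₂ _+_ (trans (∑-+ _ _)
      (cong₂ _+_ (double-count n j (suc l) (g ∘ fix true)) (double-count n j (suc l) (g ∘ fix false))))
      (double-count n j l (g ∘ free))))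
  -- Pascal's rule needs l < n. Otherwise Q_n has no face of dimension l + 1 and `G x` is an empty
  -- sum.
  weight : ∀ x → (a + b) * G x ≡ m * G x
  weight x with l <? n
  ... | yes l<n = cong (_* G x) (#above-pascal {l} {n} {j} l<n)
  ... | no l≮n rewrite ∑-empty (s≤s (≮⇒≥ l≮n)) (g ∘ fix x) = trans (*-zeroʳ (a + b)) (sym (*-zeroʳ m))
  collect : ∀ a b m x y z → a * x + a * y + (b * x + b * y + m * z) ≡ (a + b) * x + (a + b) * y + m * z
  collect = solve-∀
  distr : ∀ m x y z → m * (x + y + z) ≡ m * x + m * y + m * z
  distr = solve-∀

-- Faces broken by a set of missing edges

-- Incident pairs of a j-face and an l-face inside it, counted from both ends.
#faces-* : ∀ n j l → #above n j l * #faces n l ≡ #faces n j * #faces j l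
#faces-* n j l = trans (sym (double-count n j l (λ _ → 1)))
  (trans (∑-cong {f = λ _ → #faces j l} {g = λ _ → #faces j l * 1} (λ _ → sym (*-identityʳ _)))
    (trans (∑-*ˡ (#faces j l) (λ _ → 1)) (*-comm (#faces j l) (#faces n j))))

#faces-vertex : ∀ n → #faces n 0 ≡ 2 ^ n
#faces-vertex zero    = ∑-point (λ _ → 1)
#faces-vertex (suc n) = trans (∑-vertex (λ _ → 1))
  (cong₂ _+_ (#faces-vertex n) (trans (#faces-vertex n) (sym (+-identityʳ _))))

#faces-edge : ∀ n → 2 * #faces n 1 ≡ n * 2 ^ n
#faces-edge zero    = cong (2 *_) (∑-empty {zero} {1} z<s (λ _ → 1))
#faces-edge (suc n) = begin
  2 * #faces (suc n) 1              ≡⟨ cong (2 *_) (∑-face (λ _ → 1)) ⟩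
  2 * (x + x + #faces n 0)          ≡⟨ cong (λ v → 2 * (x + x + v)) (#faces-vertex n) ⟩
  2 * (x + x + 2 ^ n)               ≡⟨ rearrange x (2 ^ n) ⟩
  2 * x + 2 * x + 2 * 2 ^ n         ≡⟨ cong (λ y → y + y + 2 * 2 ^ n) (#faces-edge n) ⟩
  n * 2 ^ n + n * 2 ^ n + 2 * 2 ^ n ≡⟨ collect n (2 ^ n) ⟩
  suc n * (2 * 2 ^ n)               ∎
  where
  open ≡-Reasoning
  x = #faces n 1
  rearrange : ∀ x y → 2 * (x + x + y) ≡ 2 * x + 2 * x + 2 * y
  rearrange = solve-∀
  collect : ∀ n y → n * y + n * y + 2 * y ≡ suc n * (2 * y)
  collect = solve-∀

#faces-pos : l ≤ n → 0 < #faces n l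
#faces-pos {zero}  {n}     _         rewrite #faces-vertex n = m^n>0 2 n
#faces-pos {suc l} {suc n} (s≤s l≤n) rewrite ∑-face {n} {l} (λ _ → 1) =
  ≤-trans (#faces-pos l≤n) (m≤n+m (#faces n l) (#faces n (suc l) + #faces n (suc l)))

#faces-nonZero : l ≤ n → NonZero (#faces n l)
#faces-nonZero l≤n = >-nonZero (#faces-pos l≤n)

-- A uniform l-face of a uniform j-face is a uniform l-face of Q_n, so a lower bound on the mean of
-- `g` inside every j-face is also one on its mean over Q_n. Denominators are cleared.
averaging : (t : ℕ) (g : Face n l → ℕ) → j ≤ n →
            (∀ (c : Face n j) → t ≤ ∑ (λ d → g (c ⊙ d))) →
            t * #faces n l ≤ ∑ g * #faces j l
averaging {n} {l} {j} t g j≤n t≤ = *-cancelˡ-≤ (#faces n j) (begin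
  #faces n j * (t * #faces n l)             ≡⟨ shuffle₁ (#faces n j) t (#faces n l) ⟩
  (t * #faces n j) * #faces n l             ≡⟨ cong (_* #faces n l) constant ⟨
  ∑ {n} {j} (λ _ → t) * #faces n l          ≤⟨ *-monoˡ-≤ (#faces n l) (∑-mono t≤) ⟩
  ∑ (λ c → ∑ (λ d → g (c ⊙ d))) * #faces n l ≡⟨ cong (_* #faces n l) (double-count n j l g) ⟩
  (#above n j l * ∑ g) * #faces n l         ≡⟨ shuffle₂ (#above n j l) (∑ g) (#faces n l) ⟩
  ∑ g * (#above n j l * #faces n l)         ≡⟨ cong (∑ g *_) (#faces-* n j l) ⟩
  ∑ g * (#faces n j * #faces j l)           ≡⟨ shuffle₃ (∑ g) (#faces n j) (#faces j l) ⟩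
  #faces n j * (∑ g * #faces j l)           ∎)
  where
  open ≤-Reasoning
  instance _ = #faces-nonZero j≤n
  constant : ∑ {n} {j} (λ _ → t) ≡ t * #faces n j
  constant = trans (∑-cong λ _ → sym (*-identityʳ t)) (∑-*ˡ t (λ _ → 1))
  shuffle₁ : ∀ x t y → x * (t * y) ≡ t * x * y
  shuffle₁ = solve-∀
  shuffle₂ : ∀ x t y → x * t * y ≡ t * (x * y)
  shuffle₂ = solve-∀
  shuffle₃ : ∀ x t y → x * (t * y) ≡ t * (x * y)
  shuffle₃ = solve-∀

-- The same sampling of an i-face through an l-face, now with a bound that depends on the l-face.
-- With i = 1 it compares the density of missing edges with that of broken l-faces.
density-mono : (g : Face n i → ℕ) (h : Face n l → ℕ) → i ≤ l →
               (∀ c → ∑ (λ d → g (c ⊙ d)) ≤ h c * #faces l i) →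
               ∑ g * #faces n l ≤ ∑ h * #faces n i
density-mono {n} {i} {l} g h i≤l ≤h = *-cancelʳ-≤ _ _ (#faces l i) (begin
  ∑ g * #faces n l * #faces l i           ≡⟨ *-assoc (∑ g) (#faces n l) (#faces l i) ⟩
  ∑ g * (#faces n l * #faces l i)         ≡⟨ cong (∑ g *_) (#faces-* n l i) ⟨
  ∑ g * (#above n l i * #faces n i)       ≡⟨ shuffle₁ (∑ g) (#above n l i) (#faces n i) ⟩
  #above n l i * ∑ g * #faces n i         ≡⟨ cong (_* #faces n i) (double-count n l i g) ⟨
  ∑ (λ c → ∑ (λ d → g (c ⊙ d))) * #faces n i ≤⟨ *-monoˡ-≤ (#faces n i) (∑-mono ≤h) ⟩
  ∑ (λ c → h c * #faces l i) * #faces n i ≡⟨ cong (_* #faces n i) constant ⟩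
  #faces l i * ∑ h * #faces n i           ≡⟨ shuffle₂ (#faces l i) (∑ h) (#faces n i) ⟩
  ∑ h * #faces n i * #faces l i           ∎)
  where
  open ≤-Reasoning
  instance _ = #faces-nonZero i≤l
  constant : ∑ (λ c → h c * #faces l i) ≡ #faces l i * ∑ h
  constant = trans (∑-cong λ c → *-comm (h c) _) (∑-*ˡ (#faces l i) h)
  shuffle₁ : ∀ x t y → x * (t * y) ≡ t * x * y
  shuffle₁ = solve-∀
  shuffle₂ : ∀ x t y → x * t * y ≡ t * y * x
  shuffle₂ = solve-∀

face-dim : Face n l → l ≤ n
face-dim point     = z≤n
face-dim (fix b c) = m≤n⇒m≤1+n (face-dim c)
face-dim (free c)  = s≤s (face-dim c)

∑-fix-free≤ : ∀ b (g : Face (suc n) (suc l) → ℕ) → ∑ (g ∘ fix b) + ∑ (g ∘ free) ≤ ∑ g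
∑-fix-free≤ true  g rewrite ∑-face g = +-monoˡ-≤ (∑ (g ∘ free)) (m≤m+n (∑ (g ∘ fix true)) _)
∑-fix-free≤ false g rewrite ∑-face g = +-monoˡ-≤ (∑ (g ∘ free)) (m≤n+m _ (∑ (g ∘ fix true)))

∑-fix≤ : ∀ b (g : Face (suc n) l → ℕ) → ∑ (g ∘ fix b) ≤ ∑ g
∑-fix≤ {l = suc l} b     g = ≤-trans (m≤m+n _ (∑ (g ∘ free))) (∑-fix-free≤ b g)
∑-fix≤ {l = zero}  true  g rewrite ∑-vertex g = m≤m+n _ _
∑-fix≤ {l = zero}  false g rewrite ∑-vertex g = m≤n+m _ _

#above-suc : ∀ j → i ≤ n → #above (suc n) (suc j) i ≤ #above n (suc j) i + #above n j i
#above-suc {zero}  {n} j _   = ≤-reflexive (sym (pascal n j))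
#above-suc {suc i} {n} j i<n = ≤-reflexive (sym (#above-pascal {i} {n} {j} i<n))

#above-suc-zero : ∀ n i → #above (suc n) 0 i ≤ #above n 0 i
#above-suc-zero n zero    = ≤-refl
#above-suc-zero n (suc i) = z≤n

-- The l-faces around `e` are built coordinate by coordinate: where `e` is fixed, the larger face is
-- free or fixed at the same value; where `e` is free, so is the larger face. Each of them
-- contributes at least 1 to the sum.
#above-≤-∑ : (e : Face n i) (g : Face n l → ℕ) →
             (∀ d e′ → d ⊙ e′ ≡ e → 1 ≤ g d) → #above n l i ≤ ∑ g
#above-≤-∑ {l = zero}  point g 1≤g = ≤-trans (1≤g point point refl) (≤-reflexive (sym (∑-point g)))
#above-≤-∑ {l = suc l} point g 1≤g = z≤n
#above-≤-∑ {suc n} {i} {zero} (fix b e) g 1≤g = begin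
  #above (suc n) 0 i ≤⟨ #above-suc-zero n i ⟩
  #above n 0 i       ≤⟨ #above-≤-∑ e (g ∘ fix b) (λ d e′ eq → 1≤g (fix b d) e′ (cong (fix b) eq)) ⟩
  ∑ (g ∘ fix b)      ≤⟨ ∑-fix≤ b g ⟩
  ∑ g                ∎
  where open ≤-Reasoning
#above-≤-∑ {suc n} {i} {suc l} (fix b e) g 1≤g = begin
  #above (suc n) (suc l) i        ≤⟨ #above-suc l (face-dim e) ⟩
  #above n (suc l) i + #above n l i
    ≤⟨ +-mono-≤ (#above-≤-∑ e (g ∘ fix b) (λ d e′ eq → 1≤g (fix b d) e′ (cong (fix b) eq)))
                (#above-≤-∑ e (g ∘ free) (λ d e′ eq → 1≤g (free d) (fix b e′) (cong (fix b) eq))) ⟩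
  ∑ (g ∘ fix b) + ∑ (g ∘ free)    ≤⟨ ∑-fix-free≤ b g ⟩
  ∑ g                             ∎
  where open ≤-Reasoning
#above-≤-∑ {l = zero}  (free e) g 1≤g = z≤n
#above-≤-∑ {l = suc l} (free e) g 1≤g =
  ≤-trans (#above-≤-∑ e (g ∘ free) (λ d e′ eq → 1≤g (free d) (free e′) (cong free eq)))
    (≤-trans (m≤n+m _ (∑ (g ∘ fix true))) (∑-fix-free≤ true g))

∈-faces : (c : Face n l) → c ∈ faces n l
∈-faces point = here refl
∈-faces {suc n} {zero}  (fix true  c) = ∈-++⁺ˡ (∈-map⁺ (fix true) (∈-faces c))
∈-faces {suc n} {zero}  (fix false c) = ∈-++⁺ʳ (map (fix true) (faces n 0)) (∈-map⁺ (fix false) (∈-faces c))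
∈-faces {suc n} {suc l} (fix true  c) = ∈-++⁺ˡ (∈-++⁺ˡ (∈-map⁺ (fix true) (∈-faces c)))
∈-faces {suc n} {suc l} (fix false c) =
  ∈-++⁺ˡ (∈-++⁺ʳ (map (fix true) (faces n (suc l))) (∈-map⁺ (fix false) (∈-faces c)))
∈-faces {suc n} {suc l} (free c) = ∈-++⁺ʳ (map (fix true) (faces n (suc l)) ++ _) (∈-map⁺ free (∈-faces c))

all-faces? : {P : Face n l → Set} → Decidable P → Dec (∀ c → P c)
all-faces? {n} {l} P? = map′ (λ all c → All.lookup all (∈-faces c)) (λ f → All.tabulate (λ {c} _ → f c))
  (All.all? P? (faces n l))

¬all-faces : {P : Face n l → Set} → Decidable P → ¬ (∀ c → P c) → ∃ λ c → ¬ P c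
¬all-faces {n} {l} P? ¬all = Any.satisfied (¬All⇒Any¬ P? (faces n l)
  (λ all → ¬all (λ c → All.lookup all (∈-faces c))))

indicator : {P : Set} → Dec P → ℕ
indicator P? = if does P? then 1 else 0

indicator-yes : {P : Set} (P? : Dec P) → P → indicator P? ≡ 1
indicator-yes (yes _) _ = refl
indicator-yes (no ¬p) p = contradiction p ¬p

indicator-no : {P : Set} (P? : Dec P) → ¬ P → indicator P? ≡ 0
indicator-no (yes p) ¬p = contradiction p ¬p
indicator-no (no _)  _  = refl

indicator-¬ : {P : Set} (P? : Dec P) → indicator P? + indicator (¬? P?) ≡ 1
indicator-¬ (yes _) = refl
indicator-¬ (no _)  = refl

indicator≤1 : {P : Set} (P? : Dec P) → indicator P? ≤ 1
indicator≤1 (yes _) = s≤s z≤n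
indicator≤1 (no _)  = z≤n

length-filter≡sum : {P : X → Set} (P? : Decidable P) (xs : List X) →
                    length (filter P? xs) ≡ sumOver xs (indicator ∘ P?)
length-filter≡sum P? []       = refl
length-filter≡sum P? (x ∷ xs) with P? x
... | yes _ = cong suc (length-filter≡sum P? xs)
... | no  _ = length-filter≡sum P? xs

-- The edges mapped to true are those present in a spanning subgraph of Q_n.
EdgeSet : ℕ → Set
EdgeSet n = Face n 1 → Bool

Intact : EdgeSet n → Face n l → Set
Intact p c = ∀ e → p (c ⊙ e) ≡ true

intact? : (p : EdgeSet n) (c : Face n l) → Dec (Intact p c)
intact? p c = all-faces? (λ e → p (c ⊙ e) Bool.≟ true)

FaceFree : ℕ → EdgeSet n → Set
FaceFree k p = ∀ (c : Face _ k) → ¬ Intact p c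

#intact #broken : ℕ → EdgeSet n → ℕ
#intact l p = ∑ {l = l} (λ c → indicator (intact? p c))
#broken l p = ∑ {l = l} (λ c → indicator (¬? (intact? p c)))

#missing : EdgeSet n → ℕ
#missing p = ∑ (λ e → indicator (p e Bool.≟ false))

#intact+#broken : ∀ l (p : EdgeSet n) → #intact l p + #broken l p ≡ #faces n l
#intact+#broken l p = trans (sym (∑-+ {l = l} _ _)) (∑-cong (λ c → indicator-¬ (intact? p c)))

missing-edge : (p : EdgeSet n) (c : Face n l) → ¬ Intact p c → ∃ λ e → p (c ⊙ e) ≡ false
missing-edge p c broken with ¬all-faces (λ e → p (c ⊙ e) Bool.≟ true) broken
... | e , p≢true with p (c ⊙ e) in eq
...   | true  = contradiction refl p≢true
...   | false = e , eq

missing⇒broken : (p : EdgeSet n) (c : Face n l) (e : Face l 1) → p (c ⊙ e) ≡ false → ¬ Intact p c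
missing⇒broken p c e eq intact with () ← trans (sym eq) (intact e)

-- One missing edge in a k-face breaks all `#above k l 1` of its l-faces through that edge, and
-- `averaging` carries this proportion over to Q_n.
broken-upper : (p : EdgeSet n) → FaceFree k p → 1 ≤ k → l ≤ k → k ≤ n →
               #faces l 1 * #faces n l ≤ #broken l p * #faces k 1
broken-upper {n} {k} {l} p k-free 1≤k l≤k k≤n = *-cancelˡ-≤ (#faces k l) (begin
  #faces k l * (#faces l 1 * #faces n l)      ≡⟨ *-assoc (#faces k l) (#faces l 1) (#faces n l) ⟨
  -- Counting the edges of the l-faces of Q_k shows that the proportion of l-faces through a given
  -- edge is `#faces l 1` over `#faces k 1`.
  #faces k l * #faces l 1 * #faces n l        ≡⟨ cong (_* #faces n l) (#faces-* k l 1) ⟨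
  #above k l 1 * #faces k 1 * #faces n l      ≡⟨ shuffle₁ (#above k l 1) (#faces k 1) (#faces n l) ⟩
  #above k l 1 * #faces n l * #faces k 1      ≤⟨ *-monoˡ-≤ (#faces k 1) (averaging (#above k l 1) _ k≤n local) ⟩
  #broken l p * #faces k l * #faces k 1       ≡⟨ shuffle₂ (#broken l p) (#faces k l) (#faces k 1) ⟩
  #faces k l * (#broken l p * #faces k 1)     ∎)
  where
  open ≤-Reasoning
  instance _ = #faces-nonZero l≤k
  local : (c : Face n k) → #above k l 1 ≤ ∑ {k} {l} (λ d → indicator (¬? (intact? p (c ⊙ d))))
  local c = let e , missing = missing-edge p c (k-free c) in
    #above-≤-∑ e _ (λ d e′ eq → ≤-reflexive (sym (indicator-yes (¬? (intact? p (c ⊙ d)))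
      (missing⇒broken p (c ⊙ d) e′
        (trans (cong p (trans (⊙-assoc c d e′) (cong (c ⊙_) eq))) missing)))))
  shuffle₁ : ∀ x y z → x * y * z ≡ x * z * y
  shuffle₁ = solve-∀
  shuffle₂ : ∀ x y z → x * y * z ≡ y * (x * z)
  shuffle₂ = solve-∀

-- Logarithmically many missing edges

bitAt : Face n 0 → Fin n → Bool
bitAt (fix b c) zero    = b
bitAt (fix b c) (suc i) = bitAt c i

whole : ∀ n → Face n n
whole zero    = point
whole (suc n) = free (whole n)

whole-⊙ : (c : Face n l) → whole n ⊙ c ≡ c
whole-⊙ point     = refl
whole-⊙ (fix b c) = cong (fix b) (whole-⊙ c)
whole-⊙ (free c)  = cong free (whole-⊙ c)

facet : Fin (suc n) → Bool → Face (suc n) n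
facet         zero    b = fix b (whole _)
facet {suc n} (suc i) b = free (facet i b)

bitAt-facet : ∀ i b (v : Face n 0) → bitAt (facet i b ⊙ v) i ≡ b
bitAt-facet         zero    b v         = refl
bitAt-facet {suc n} (suc i) b (fix x v) = bitAt-facet i b v

bitAt-facet-punchIn : ∀ i b (v : Face n 0) j → bitAt (facet i b ⊙ v) (punchIn i j) ≡ bitAt v j
bitAt-facet-punchIn         zero    b v         j       = cong (λ u → bitAt u j) (whole-⊙ v)
bitAt-facet-punchIn {suc n} (suc i) b (fix x v) zero    = refl
bitAt-facet-punchIn {suc n} (suc i) b (fix x v) (suc j) = bitAt-facet-punchIn i b v j

toBit : Bool → Fin 2
toBit false = zero
toBit true  = suc zero

toBit-injective : ∀ a b → toBit a ≡ toBit b → a ≡ b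
toBit-injective false false _ = refl
toBit-injective true  true  _ = refl

-- If coordinates i ≠ j take equal values at a chosen endpoint of every missing
-- edge, then the face x_i = 0, x_j = 1 contains no missing edge.  Hence the
-- coordinates give distinct 0-1 vectors of length #missing p.
log-missing : (p : EdgeSet (2 + k)) → FaceFree k p → 2 + k ≤ 2 ^ #missing p
log-missing {k} p k-free = subst (λ s → 2 + k ≤ 2 ^ s) size (injective⇒≤ {f = code} code-injective)
  where
  missing? : Decidable (λ e → p e ≡ false)
  missing? e = p e Bool.≟ false
  missing : List (Face (2 + k) 1)
  missing = filter missing? (faces (2 + k) 1)
  size : length missing ≡ #missing p
  size = trans (length-filter≡sum missing? (faces (2 + k) 1)) (sym (∑-def _))
  endpoint : Face l 1 → Face l 0
  endpoint e = e ⊙ fix false point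
  column : Fin (2 + k) → Fin (length missing) → Fin 2
  column i a = toBit (bitAt (endpoint (List.lookup missing a)) i)
  code : Fin (2 + k) → Fin (2 ^ length missing)
  code = funToFin ∘ column
  code-injective : ∀ {i j} → code i ≡ code j → i ≡ j
  code-injective {i} {j} eq with i Fin.≟ j
  ... | yes i≡j = i≡j
  ... | no  i≢j = contradiction (trans (sym value-i) (trans agree value-j)) (λ ())
    where
    -- The face with coordinate i fixed numbers the remaining coordinates anew, and j becomes `j′`.
    j′ = punchOut i≢j
    c = facet i false ⊙ facet j′ true
    broken : ∃ λ e → p (c ⊙ e) ≡ false
    broken = missing-edge p c (k-free c)
    e = proj₁ broken
    e∈ : c ⊙ e ∈ missing
    e∈ = ∈-filter⁺ missing? (∈-faces (c ⊙ e)) (proj₂ broken)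
    v = endpoint (c ⊙ e)
    v≡ : v ≡ facet i false ⊙ (facet j′ true ⊙ endpoint e)
    v≡ = trans (⊙-assoc c e _) (⊙-assoc (facet i false) (facet j′ true) (endpoint e))
    value-i : bitAt v i ≡ false
    value-i = trans (cong (λ u → bitAt u i) v≡) (bitAt-facet i false _)
    value-j : bitAt v j ≡ true
    value-j = trans (cong₂ bitAt v≡ (sym (punchIn-punchOut i≢j)))
      (trans (bitAt-facet-punchIn i false (facet j′ true ⊙ endpoint e) j′) (bitAt-facet j′ true (endpoint e)))
    column≡ : column i (index e∈) ≡ column j (index e∈)
    column≡ = trans (sym (finToFun-funToFin (column i) (index e∈)))
      (trans (cong (λ x → finToFun x (index e∈)) eq) (finToFun-funToFin (column j) (index e∈)))
    agree : bitAt v i ≡ bitAt v j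
    agree rewrite lookup-index e∈ = toBit-injective _ _ column≡

-- For n ≥ 1 the exponent is log₂ n rounded up. Minimality is the form in which it turns
-- `log-missing` into a lower bound on the number of missing edges.
least-power : ∀ n → ∃ λ t → n ≤ 2 ^ t × (∀ s → n ≤ 2 ^ s → t ≤ s)
least-power zero    = 0 , z≤n , λ _ _ → z≤n
least-power (suc n) with least-power n
... | t , n≤2^t , least with suc n ≤? 2 ^ t
...   | yes n<2^t = t , n<2^t , λ s n<2^s → least s (<⇒≤ n<2^s)
-- Since 2 ^ t is positive, doubling it gains at least 1.
...   | no  n≮2^t = suc t , ≤-trans (+-mono-≤ (m^n>0 2 t) n≤2^t) (≤-reflexive (cong (2 ^ t +_) (sym (+-identityʳ _))))
        , λ s n<2^s → ≰⇒> (λ s≤t → n≮2^t (≤-trans n<2^s (^-monoʳ-≤ 2 s≤t)))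

-- Every (k + 2)-face misses at least t edges by `log-missing`, so `averaging` bounds the density of
-- missing edges in Q_n from below, and `density-mono` passes to broken l-faces.
broken-log : (p : EdgeSet n) (t : ℕ) → FaceFree k p → 1 ≤ l → l ≤ n → 2 + k ≤ n →
             (∀ s → 2 + k ≤ 2 ^ s → t ≤ s) →
             t * #faces n l ≤ #broken l p * #faces (2 + k) 1
broken-log {n} {k} {l} p t k-free 1≤l l≤n 2+k≤n least = *-cancelˡ-≤ (#faces n 1) (begin
  #faces n 1 * (t * #faces n l)                 ≡⟨ shuffle₁ (#faces n 1) t (#faces n l) ⟩
  t * #faces n 1 * #faces n l                   ≤⟨ *-monoˡ-≤ (#faces n l) (averaging t _ 2+k≤n local) ⟩
  #missing p * #faces (2 + k) 1 * #faces n l    ≡⟨ shuffle₂ (#missing p) (#faces (2 + k) 1) (#faces n l) ⟩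
  #missing p * #faces n l * #faces (2 + k) 1
    ≤⟨ *-monoˡ-≤ (#faces (2 + k) 1) (density-mono _ (λ d → indicator (¬? (intact? p d))) 1≤l in-face) ⟩
  #broken l p * #faces n 1 * #faces (2 + k) 1   ≡⟨ shuffle₃ (#broken l p) (#faces n 1) (#faces (2 + k) 1) ⟩
  #faces n 1 * (#broken l p * #faces (2 + k) 1) ∎)
  where
  open ≤-Reasoning
  instance _ = #faces-nonZero (≤-trans 1≤l l≤n)
  local : (c : Face n (2 + k)) → t ≤ #missing (p ∘ (c ⊙_))
  local c = least _ (log-missing (p ∘ (c ⊙_))
    (λ d intact → k-free (c ⊙ d) (λ e → trans (cong p (⊙-assoc c d e)) (intact e))))
  -- An intact l-face has no missing edge, and a broken one has at most all of its edges missing.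
  in-face′ : (d : Face n l) (D : Dec (Intact p d)) →
             ∑ (λ e → indicator (p (d ⊙ e) Bool.≟ false)) ≤ indicator (¬? D) * #faces l 1
  in-face′ d (no  _)      = ≤-trans (∑-mono (λ e → indicator≤1 (p (d ⊙ e) Bool.≟ false))) (≤-reflexive (sym (*-identityˡ _)))
  in-face′ d (yes intact) = ≤-reflexive (trans
    (∑-cong (λ e → indicator-no (p (d ⊙ e) Bool.≟ false) (λ eq → missing⇒broken p d e eq intact)))
    (∑-zero l 1))
  in-face : (d : Face n l) → ∑ (λ e → indicator (p (d ⊙ e) Bool.≟ false)) ≤ indicator (¬? (intact? p d)) * #faces l 1
  in-face d = in-face′ d (intact? p d)
  shuffle₁ : ∀ x y z → x * (y * z) ≡ y * x * z
  shuffle₁ = solve-∀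
  shuffle₂ : ∀ x y z → x * y * z ≡ x * z * y
  shuffle₂ = solve-∀
  shuffle₃ : ∀ x y z → x * y * z ≡ y * (x * z)
  shuffle₃ = solve-∀

-- Edge colourings

-- A minimum is at most the average; the separate head `x` keeps the list nonempty.
least-term : ∀ (x : X) xs f → ∃ λ y → suc (length xs) * f y ≤ sumOver (x ∷ xs) f
least-term x []       f = x , ≤-refl
least-term x (y ∷ ys) f with least-term y ys f
... | z , bound with f x ≤? f z
...   | yes fx≤fz = x , +-monoʳ-≤ (f x) (≤-trans (*-monoʳ-≤ (suc (length ys)) fx≤fz) bound)
...   | no  fx≰fz = z , +-mono-≤ (≰⇒≥ fx≰fz) bound

occurrences : List (Fin P) → Fin P → ℕ
occurrences ys x = sumOver ys (λ y → indicator (x Fin.≟ y))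

∈⇒occurrences : ∀ {x : Fin P} {ys} → x ∈ ys → 1 ≤ occurrences ys x
∈⇒occurrences {x = x} {y ∷ ys} (here refl) rewrite indicator-yes (x Fin.≟ x) refl = s≤s z≤n
∈⇒occurrences {x = x} {y ∷ ys} (there x∈) = ≤-trans (∈⇒occurrences x∈) (m≤n+m _ (indicator (x Fin.≟ y)))

sumOver-absent : ∀ {y : Fin P} {xs} → All (y ≢_) xs → sumOver xs (λ x → indicator (x Fin.≟ y)) ≡ 0
sumOver-absent []          = refl
sumOver-absent {y = y} {x ∷ xs} (y≢x ∷ y∉) rewrite indicator-no (x Fin.≟ y) (y≢x ∘ sym) = sumOver-absent y∉

sumOver-unique : ∀ (y : Fin P) {xs} → Unique xs → sumOver xs (λ x → indicator (x Fin.≟ y)) ≤ 1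
sumOver-unique y [] = z≤n
sumOver-unique y {x ∷ xs} (x∉ ∷ u) with x Fin.≟ y
... | yes refl = ≤-reflexive (cong suc (sumOver-absent x∉))
... | no  _    = sumOver-unique y u

sumOver-one : ∀ (xs : List X) → sumOver xs (λ _ → 1) ≡ length xs
sumOver-one []       = refl
sumOver-one (x ∷ xs) = cong suc (sumOver-one xs)

sum-occurrences : ∀ (ys : List (Fin P)) → sumOver (allFin P) (occurrences ys) ≤ length ys
sum-occurrences {P} ys = begin
  sumOver (allFin P) (occurrences ys)
    ≡⟨ sumOver-swap (allFin P) ys (λ x y → indicator (x Fin.≟ y)) ⟩
  sumOver ys (λ y → sumOver (allFin P) (λ x → indicator (x Fin.≟ y)))
    ≤⟨ sumOver-mono ys (λ y → sumOver-unique y (allFin⁺ P)) ⟩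
  sumOver ys (λ _ → 1)
    ≡⟨ sumOver-one ys ⟩
  length ys ∎
  where open ≤-Reasoning

module Colouring (χ : Face n 1 → Fin P) where

  avoid : Fin P → EdgeSet n
  avoid x e = not (does (χ e Fin.≟ x))

  avoid-false : ∀ x e → χ e ≡ x → avoid x e ≡ false
  avoid-false x e eq with χ e Fin.≟ x
  ... | yes _ = refl
  ... | no ¬p = contradiction eq ¬p

  -- If deleting colour `x` breaks `d`, then `d` has an edge of that colour, so `x` is listed in
  -- `cols`.
  broken≤occurrences : (d : Face n l) (cols : List (Fin P)) → (∀ e → χ (d ⊙ e) ∈ cols) →
    ∀ x (D : Dec (Intact (avoid x) d)) → indicator (¬? D) ≤ occurrences cols x
  broken≤occurrences d cols covers x (yes _) = z≤n
  broken≤occurrences d cols covers x (no broken) with missing-edge (avoid x) d broken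
  ... | e , missing with χ (d ⊙ e) Fin.≟ x
  ...   | yes refl = ∈⇒occurrences (covers e)

  -- Deleting any one colour leaves no intact k-face. Over all P deletions an l-face is broken at
  -- most once per colour in its list, hence at most w times, and the cheapest deletion breaks at
  -- most the average number.
  sparse : 1 ≤ P → (w : ℕ) →
           (∀ (c : Face n k) x → ∃ λ e → χ (c ⊙ e) ≡ x) →
           (∀ (d : Face n l) → ∃ λ cols → length cols ≤ w × (∀ e → χ (d ⊙ e) ∈ cols)) →
           ∃ λ p → FaceFree k p × P * #broken l p ≤ w * #faces n l
  sparse {k} {l} 1≤P w all-colours few-colours = avoid best , free-of , (begin
    P * #broken l (avoid best)                        ≤⟨ proj₂ choice ⟩
    sumOver (allFin P) (λ x → #broken l (avoid x))
      ≡⟨ sumOver-cong (allFin P) (λ x → ∑-def _) ⟩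
    sumOver (allFin P) (λ x → sumOver (faces n l) (λ d → brokenBy x d))
      ≡⟨ sumOver-swap (allFin P) (faces n l) brokenBy ⟩
    sumOver (faces n l) (λ d → sumOver (allFin P) (λ x → brokenBy x d))
      ≡⟨ ∑-def _ ⟨
    ∑ (λ d → sumOver (allFin P) (λ x → brokenBy x d)) ≤⟨ ∑-mono per-face ⟩
    ∑ {n} {l} (λ _ → w)                               ≡⟨ ∑-cong (λ _ → sym (*-identityʳ w)) ⟩
    ∑ {n} {l} (λ _ → w * 1)                           ≡⟨ ∑-*ˡ w (λ _ → 1) ⟩
    w * #faces n l                                    ∎)
    where
    open ≤-Reasoning
    brokenBy : Fin P → Face n l → ℕ
    brokenBy x d = indicator (¬? (intact? (avoid x) d))
    pick : ∀ (f : Fin P → ℕ) → 1 ≤ P → ∃ λ x → P * f x ≤ sumOver (allFin P) f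
    pick f (s≤s {n = P′} _) with least-term zero (List.tabulate suc) f
    ... | x , bound = x , subst (λ m → suc m * f x ≤ sumOver (allFin P) f) (length-tabulate {n = P′} suc) bound
    choice = pick (λ x → #broken l (avoid x)) 1≤P
    best = proj₁ choice
    free-of : FaceFree k (avoid best)
    free-of c intact with all-colours c best
    ... | e , eq = missing⇒broken (avoid best) c e (avoid-false best (c ⊙ e) eq) intact
    per-face : ∀ d → sumOver (allFin P) (λ x → brokenBy x d) ≤ w
    per-face d with few-colours d
    ... | cols , short , covers = ≤-trans
      (sumOver-mono (allFin P) (λ x → broken≤occurrences d cols covers x (intact? (avoid x) d)))
      (≤-trans (sum-occurrences cols) short)

-- Colouring by the number of ones

bit : Bool → ℕ
bit b = if b then 1 else 0

bit≤1 : ∀ b → bit b ≤ 1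
bit≤1 true  = ≤-refl
bit≤1 false = z≤n

ones : Face n l → ℕ
ones point     = 0
ones (fix b c) = bit b + ones c
ones (free c)  = ones c

onesLeft onesRight : Face n 1 → ℕ
onesLeft  (fix b e) = bit b + onesLeft e
onesLeft  (free e)  = 0
onesRight (fix b e) = onesRight e
onesRight (free e)  = ones e

ones-⊙ : (c : Face n j) (d : Face j l) → ones (c ⊙ d) ≡ ones c + ones d
ones-⊙ point     d         = refl
ones-⊙ (fix b c) d         = trans (cong (bit b +_) (ones-⊙ c d)) (sym (+-assoc (bit b) _ _))
ones-⊙ (free c)  (fix b d) = trans (cong (bit b +_) (ones-⊙ c d)) (swap (bit b) (ones c) (ones d))
  where
  swap : ∀ x y z → x + (y + z) ≡ y + (x + z)
  swap = solve-∀
ones-⊙ (free c)  (free d)  = ones-⊙ c d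

ones-vertex≤ : (v : Face n 0) → ones v ≤ n
ones-vertex≤ point     = z≤n
ones-vertex≤ (fix b v) = +-mono-≤ (bit≤1 b) (ones-vertex≤ v)

ones-edge< : (e : Face n 1) → ones e < n
ones-edge< (free v)  = s≤s (ones-vertex≤ v)
ones-edge< (fix b e) = ≤-trans (≤-reflexive (sym (+-suc (bit b) (ones e)))) (+-mono-≤ (bit≤1 b) (ones-edge< e))

vertex-with-ones : ∀ {r} → r ≤ n → ∃ λ (v : Face n 0) → ones v ≡ r
vertex-with-ones {zero}  z≤n = point , refl
vertex-with-ones {suc n} z≤n with vertex-with-ones {n} z≤n
... | v , eq = fix false v , eq
vertex-with-ones (s≤s r≤n) with vertex-with-ones r≤n
... | v , eq = fix true v , cong suc eq

edge-with-ones : ∀ {r} → r < n → ∃ λ (e : Face n 1) → ones e ≡ r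
edge-with-ones (s≤s r≤n) with vertex-with-ones r≤n
... | v , eq = free v , eq

-- The numbers a, ..., a + s cover all residues modulo s + 1. When a grows by one, r drops by one,
-- and r = 0 wraps around to s.
residue-shift-ℕ : ∀ s a (x : Fin (suc s)) → ∃ λ r → r < suc s × (a + r) % suc s ≡ toℕ x
residue-shift-ℕ s zero    x = toℕ x , toℕ<n x , m<n⇒m%n≡m (toℕ<n x)
residue-shift-ℕ s (suc a) x with residue-shift-ℕ s a x
... | suc r , r<s , eq = r , ≤-trans (n≤1+n _) r<s , trans (cong (_% suc s) (sym (+-suc a r))) eq
... | zero  , _   , eq = s , ≤-refl , trans (cong (_% suc s) (sym (+-suc a s)))
  (trans ([m+n]%n≡m%n a (suc s)) (trans (cong (_% suc s) (sym (+-identityʳ a))) eq))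

residue-shift : ∀ s .{{_ : NonZero s}} a (x : Fin s) → ∃ λ r → r < s × (a + r) mod s ≡ x
residue-shift (suc s) a x with residue-shift-ℕ s a x
... | r , r<s , eq = r , r<s , toℕ-injective (trans (toℕ-fromℕ< _) eq)

-- The numbers of ones on the edges of a j-face are j consecutive integers, beginning with the
-- number of constant ones of the face. Modulo k they give all residues if j = k, and at most l of
-- them if j = l.
sparse-by-level : ∀ n k l → 1 ≤ k → ∃ λ (p : EdgeSet n) → FaceFree k p × k * #broken l p ≤ l * #faces n l
sparse-by-level n k l 1≤k = Colouring.sparse χ 1≤k l all-colours few-colours
  where
  instance _ = >-nonZero 1≤k
  χ : Face n 1 → Fin k
  χ e = ones e mod k
  all-colours : (c : Face n k) (x : Fin k) → ∃ λ e → χ (c ⊙ e) ≡ x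
  all-colours c x with residue-shift k (ones c) x
  ... | r , r<k , eq with edge-with-ones r<k
  ...   | e , refl = e , trans (cong (_mod k) (ones-⊙ c e)) eq
  few-colours : (d : Face n l) → ∃ λ cols → length cols ≤ l × (∀ e → χ (d ⊙ e) ∈ cols)
  few-colours d = map colour (upTo l) , ≤-reflexive (trans (length-map colour (upTo l)) (length-upTo l)) ,
    λ e → subst (_∈ map colour (upTo l)) (cong (_mod k) (sym (ones-⊙ d e))) (∈-map⁺ colour (∈-upTo⁺ (ones-edge< e)))
    where
    colour : ℕ → Fin k
    colour r = (ones d + r) mod k

-- Colouring by the ones on either side of an edge

length-cartesianProductWith : ∀ {X Y Z : Set} (f : X → Y → Z) xs ys →
  length (cartesianProductWith f xs ys) ≡ length xs * length ys
length-cartesianProductWith f []       ys = refl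
length-cartesianProductWith f (x ∷ xs) ys = trans (length-++ (map (f x) ys))
  (cong₂ _+_ (length-map (f x) ys) (length-cartesianProductWith f xs ys))

-- The profiles of the edges along one free coordinate of a face, with u free coordinates before it
-- and l after it; a and b count the constant ones on the two sides.
rectangle : ℕ → ℕ → ℕ → ℕ → List (ℕ × ℕ)
rectangle a b u l = cartesianProductWith (λ x y → a + x , b + y) (upTo (suc u)) (upTo (suc l))

length-rectangle : ∀ a b u l → length (rectangle a b u l) ≡ suc u * suc l
length-rectangle a b u l = trans (length-cartesianProductWith _ (upTo (suc u)) (upTo (suc l)))
  (cong₂ _*_ (length-upTo (suc u)) (length-upTo (suc l)))

∈-rectangle : ∀ a b {u l x y} → x ≤ u → y ≤ l → (a + x , b + y) ∈ rectangle a b u l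
∈-rectangle a b x≤u y≤l =
  ∈-cartesianProductWith⁺ (λ x y → a + x , b + y) (∈-upTo⁺ (s≤s x≤u)) (∈-upTo⁺ (s≤s y≤l))

-- The pairs (a + onesLeft, onesRight) of the edges of a face that is preceded by
-- a ones and u free coordinates.
profiles : ℕ → ℕ → Face n l → List (ℕ × ℕ)
profiles a u point = []
profiles a u (fix b d) = profiles (a + bit b) u d
profiles a u (free {l = l} d) =
  rectangle a (ones d) u l ++ profiles a (suc u) d

-- A free coordinate with i free coordinates before it and j after it contributes (i + 1)(j + 1)
-- pairs. For u = 0 these products, over i + j = l - 1, add up to the binomial coefficient of 3 out
-- of l + 2; a general u is carried for the induction.
length-profiles : ∀ a u (d : Face n l) → length (profiles a u d) ≡ u * (suc l C 2) + (2 + l) C 3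
length-profiles a u point     = sym (trans (+-identityʳ (u * 0)) (*-zeroʳ u))
length-profiles a u (fix b d) = length-profiles (a + bit b) u d
length-profiles a u (free {l = l} d) = begin
  length (box ++ profiles a (suc u) d)
    ≡⟨ length-++ box ⟩
  length box + length (profiles a (suc u) d)
    ≡⟨ cong₂ _+_ (length-rectangle a (ones d) u l) (length-profiles a (suc u) d) ⟩
  suc u * suc l + (suc u * (suc l C 2) + (2 + l) C 3)
    ≡⟨ regroup u (suc l) (suc l C 2) ((2 + l) C 3) ⟩
  u * (suc l + suc l C 2) + (suc l + suc l C 2 + (2 + l) C 3)
    ≡⟨ cong (λ c → u * c + (c + (2 + l) C 3)) two ⟩
  u * ((2 + l) C 2) + ((2 + l) C 2 + (2 + l) C 3)
    ≡⟨ cong (u * ((2 + l) C 2) +_) (nCk+nC[k+1]≡[n+1]C[k+1] (2 + l) 2) ⟩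
  u * ((2 + l) C 2) + (3 + l) C 3 ∎
  where
  open ≡-Reasoning
  box = rectangle a (ones d) u l
  two : suc l + suc l C 2 ≡ (2 + l) C 2
  two = trans (cong (_+ suc l C 2) (sym (nC1≡n (suc l)))) (nCk+nC[k+1]≡[n+1]C[k+1] (suc l) 1)
  regroup : ∀ u x y z → suc u * x + (suc u * y + z) ≡ u * (x + y) + (x + y + z)
  regroup = solve-∀

-- Here `x` is the number of ones that the edge has on the u free coordinates already passed. A
-- further free coordinate that `e` fixes at `b` adds `bit b` to `x` and 1 to `u`.
∈-profiles : ∀ a u x (d : Face n l) (e : Face l 1) → x ≤ u →
             (a + x + onesLeft (d ⊙ e) , onesRight (d ⊙ e)) ∈ profiles a u d
∈-profiles a u x (fix b d) e x≤u =
  subst (λ m → (m , onesRight (d ⊙ e)) ∈ profiles (a + bit b) u d) (move a (bit b) x (onesLeft (d ⊙ e)))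
    (∈-profiles (a + bit b) u x d e x≤u)
  where
  move : ∀ a b x y → a + b + x + y ≡ a + x + (b + y)
  move = solve-∀
∈-profiles a u x (free {l = l} d) (free v) x≤u =
  ∈-++⁺ˡ (subst₂ (λ p q → (p , q) ∈ rectangle a (ones d) u l) (sym (+-identityʳ (a + x))) (sym (ones-⊙ d v))
    (∈-rectangle a (ones d) x≤u (ones-vertex≤ v)))
∈-profiles a u x (free {l = l} d) (fix b e) x≤u =
  ∈-++⁺ʳ (rectangle a (ones d) u l)
    (subst (λ m → (m , onesRight (d ⊙ e)) ∈ profiles a (suc u) d) (move a (bit b) x (onesLeft (d ⊙ e)))
      (∈-profiles a (suc u) (bit b + x) d e (+-mono-≤ (bit≤1 b) x≤u)))
  where
  move : ∀ a b x y → a + (b + x) + y ≡ a + x + (b + y)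
  move = solve-∀

-- Only edges along the free coordinate number s, counted from 0, are used.
edge-with-profile : ∀ s t (d : Face n k) → k ≡ s + suc t → ∃ λ a → ∃ λ b → ∀ {x y} → x ≤ s → y ≤ t →
  ∃ λ e → onesLeft (d ⊙ e) ≡ a + x × onesRight (d ⊙ e) ≡ b + y
edge-with-profile zero    t point     ()
edge-with-profile (suc s) t point     ()
edge-with-profile s       t (fix z d) k≡ with edge-with-profile s t d k≡
... | a , b , edge = bit z + a , b , λ x≤s y≤t → let e , left , right = edge x≤s y≤t in
  e , trans (cong (bit z +_) left) (sym (+-assoc (bit z) a _)) , right
edge-with-profile zero    t (free d)  refl = 0 , ones d , λ { z≤n y≤t → let v , eq = vertex-with-ones y≤t in
  free v , refl , trans (ones-⊙ d v) (cong (ones d +_) eq) }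
edge-with-profile (suc s) t (free d)  k≡ with edge-with-profile s t d (suc-injective k≡)
-- This free coordinate takes the value 1 if x is positive, and the recursive call places the other
-- ones. Since `a` and `b` count constant ones of the face, they do not change.
... | a , b , edge = a , b , λ
  { z≤n       y≤t → let e , left , right = edge z≤n y≤t in fix false e , left , right
  ; (s≤s x≤s) y≤t → let e , left , right = edge x≤s y≤t in
      fix true e , trans (cong suc left) (sym (+-suc a _)) , right }

-- The moduli are s + 1 and t + 1. In a face of dimension s + t + 1, the edges along free coordinate
-- number s realise all shifts up to s on the left and up to t on the right, hence all pairs of
-- residues.
sparse-by-profile : ∀ n s t l → ∃ λ (p : EdgeSet n) →
  FaceFree (s + suc t) p × suc s * suc t * #broken l p ≤ ((2 + l) C 3) * #faces n l
sparse-by-profile n s t l = Colouring.sparse χ (s≤s z≤n) ((2 + l) C 3) all-colours few-colours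
  where
  colour : ℕ × ℕ → Fin (suc s * suc t)
  colour (x , y) = combine (x mod suc s) (y mod suc t)
  χ : Face n 1 → Fin (suc s * suc t)
  χ e = colour (onesLeft e , onesRight e)
  all-colours : (c : Face n (s + suc t)) (z : Fin (suc s * suc t)) → ∃ λ e → χ (c ⊙ e) ≡ z
  all-colours c z with edge-with-profile s t c refl
  ... | a , b , edge with residue-shift (suc s) a (proj₁ (remQuot {suc s} (suc t) z))
                        | residue-shift (suc t) b (proj₂ (remQuot {suc s} (suc t) z))
  ...   | x , s≤s x≤s , eqx | y , s≤s y≤t , eqy with edge x≤s y≤t
  ...     | e , left , right = e , trans
    (cong₂ combine (trans (cong (_mod suc s) left) eqx) (trans (cong (_mod suc t) right) eqy))
    (combine-remQuot {suc s} (suc t) z)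
  few-colours : (d : Face n l) → ∃ λ cols → length cols ≤ (2 + l) C 3 × (∀ e → χ (d ⊙ e) ∈ cols)
  few-colours d = map colour (profiles 0 0 d) ,
    ≤-reflexive (trans (length-map colour (profiles 0 0 d)) (length-profiles 0 0 d)) ,
    λ e → ∈-map⁺ colour (∈-profiles 0 0 0 d e z≤n)

-- The moduli s + 1 and t + 1 have sum k + 1 and are as equal as possible; for even k the bound is
-- an equality. Raising k by 2 raises both moduli by 1 and both sides of the bound by 4 k + 8.
balanced-split : ∀ k → 1 ≤ k → ∃ λ s → ∃ λ t → s + suc t ≡ k × k * (k + 2) ≤ 4 * (suc s * suc t)
balanced-split (suc zero)          _ = 0 , 0 , refl , s≤s (s≤s (s≤s z≤n))
balanced-split (suc (suc zero))    _ = 0 , 1 , refl , ≤-refl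
balanced-split (suc (suc (suc k))) _ with balanced-split (suc k) (s≤s z≤n)
... | s , t , eq , bound = suc s , suc t , cong suc (trans (+-suc s (suc t)) (cong suc eq)) , step eq bound
  where
  expandˡ : ∀ k → (2 + k) * ((2 + k) + 2) ≡ k * (k + 2) + (4 * k + 8)
  expandˡ = solve-∀
  expandʳ : ∀ s t → 4 * (suc (suc s) * suc (suc t)) ≡ 4 * (suc s * suc t) + (4 * (s + suc t) + 8)
  expandʳ = solve-∀
  step : ∀ {k s t} → s + suc t ≡ k → k * (k + 2) ≤ 4 * (suc s * suc t) →
         (2 + k) * ((2 + k) + 2) ≤ 4 * (suc (suc s) * suc (suc t))
  step {s = s} {t} refl bound =
    subst₂ _≤_ (sym (expandˡ (s + suc t))) (sym (expandʳ s t)) (+-monoˡ-≤ (4 * (s + suc t) + 8) bound)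

-- Subcubes are the only copies of cubes

bool-ext : ∀ {a b} → (a ≡ true → b ≡ true) → (b ≡ true → a ≡ true) → a ≡ b
bool-ext {true}          f g = sym (f refl)
bool-ext {false} {true}  f g = g refl
bool-ext {false} {false} f g = refl

∧-true⁻ : ∀ {a b} → a ∧ b ≡ true → a ≡ true × b ≡ true
∧-true⁻ {true} {true} _ = refl , refl

does-true⁻ : {P : Set} (P? : Dec P) → does P? ≡ true → P
does-true⁻ (yes p) _ = p

Adj⇒adj : (u v : Vertex n) → Adj u v → adj u v ≡ true
Adj⇒adj u v = cong (_≡ᵇ 1)

adj⇒Adj : (u v : Vertex n) → adj u v ≡ true → Adj u v
adj⇒Adj u v eq = ≡ᵇ⇒≡ (hamming u v) 1 (subst T (sym eq) _)

diff-refl : ∀ a → diff a a ≡ 0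
diff-refl true  = refl
diff-refl false = refl

hamming-refl : (u : Vertex n) → hamming u u ≡ 0
hamming-refl []      = refl
hamming-refl (a ∷ u) = cong₂ _+_ (diff-refl a) (hamming-refl u)

hamming-zero : (u v : Vertex n) → hamming u v ≡ 0 → u ≡ v
hamming-zero []          []          _  = refl
hamming-zero (true  ∷ u) (true  ∷ v) eq = cong (true  ∷_) (hamming-zero u v eq)
hamming-zero (false ∷ u) (false ∷ v) eq = cong (false ∷_) (hamming-zero u v eq)

flip : Fin n → Vertex n → Vertex n
flip i u = updateAt u i not

flip-involutive : ∀ i (u : Vertex n) → flip i (flip i u) ≡ u
flip-involutive i u = trans (updateAt-updateAt i u) (trans (updateAt-cong i not-involutive u) (updateAt-id i u))

Adj⇒flip : (u v : Vertex n) → Adj u v → ∃ λ i → v ≡ flip i u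
Adj⇒flip []          []          ()
Adj⇒flip (true  ∷ u) (true  ∷ v) eq = let i , eq′ = Adj⇒flip u v eq in suc i , cong (true  ∷_) eq′
Adj⇒flip (false ∷ u) (false ∷ v) eq = let i , eq′ = Adj⇒flip u v eq in suc i , cong (false ∷_) eq′
Adj⇒flip (true  ∷ u) (false ∷ v) eq = zero , cong (false ∷_) (sym (hamming-zero u v (suc-injective eq)))
Adj⇒flip (false ∷ u) (true  ∷ v) eq = zero , cong (true  ∷_) (sym (hamming-zero u v (suc-injective eq)))

diff-not : ∀ a → diff a (not a) ≡ 1
diff-not true  = refl
diff-not false = refl

diff-not-not : ∀ a b → diff (not a) (not b) ≡ diff a b
diff-not-not true  true  = refl
diff-not-not true  false = refl
diff-not-not false true  = refl
diff-not-not false false = refl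

hamming-flip : ∀ i (u v : Vertex n) → lookup u i ≡ lookup v i → hamming u (flip i v) ≡ suc (hamming u v)
hamming-flip zero    (a ∷ u) (.a ∷ v) refl = cong (_+ hamming u v) (trans (diff-not a) (cong suc (sym (diff-refl a))))
hamming-flip (suc i) (a ∷ u) (b  ∷ v) eq   = trans (cong (diff a b +_) (hamming-flip i u v eq)) (+-suc (diff a b) _)

hamming-flip-flip : ∀ i (u v : Vertex n) → hamming (flip i u) (flip i v) ≡ hamming u v
hamming-flip-flip zero    (a ∷ u) (b ∷ v) = cong (_+ hamming u v) (diff-not-not a b)
hamming-flip-flip (suc i) (a ∷ u) (b ∷ v) = cong (diff a b +_) (hamming-flip-flip i u v)

hamming-flip-one : ∀ i (u : Vertex n) → hamming u (flip i u) ≡ 1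
hamming-flip-one i u = trans (hamming-flip i u u refl) (cong suc (hamming-refl u))

-- The 4-cycle has the vertices u, flip i u, flip k (flip i u) and flip j u.
parallel : ∀ {i j k} (u : Vertex n) → Adj (flip j u) (flip k (flip i u)) →
           flip j u ≢ flip i u → flip k (flip i u) ≢ u → k ≡ j
parallel {i = i} {j} {k} u adjacent j≢i k≢i with k Fin.≟ j
... | yes k≡j = k≡j
... | no  k≢j = contradiction (trans (sym adjacent) three) (λ ())
  where
  i≢j : i ≢ j
  i≢j refl = j≢i refl
  k≢i′ : k ≢ i
  k≢i′ refl = k≢i (flip-involutive i u)
  -- For distinct i, j and k the two vertices differ in exactly these three coordinates.
  three : hamming (flip j u) (flip k (flip i u)) ≡ 3
  three = trans
    (hamming-flip k (flip j u) (flip i u)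
      (trans (lookup∘updateAt′ k j k≢j u) (sym (lookup∘updateAt′ k i k≢i′ u))))
    (cong suc (trans (hamming-flip i (flip j u) u (lookup∘updateAt′ i j i≢j u))
      (cong suc (trans (hamming-sym (flip j u) u) (hamming-flip-one j u)))))

-- The cube is connected, since coordinates can be changed one at a time. In `rigidity` this makes
-- the direction between the two halves the same at all vertices.
constant-on-cube : (g : Vertex l → X) → (∀ x y → Adj x y → g x ≡ g y) → ∀ x y → g x ≡ g y
constant-on-cube g resp []      []      = refl
constant-on-cube g resp (a ∷ x) (b ∷ y) = trans (constant-on-cube (g ∘ (a ∷_)) tail-adj x y) head
  where
  tail-adj : ∀ x y → Adj x y → g (a ∷ x) ≡ g (a ∷ y)
  tail-adj x y xy = resp (a ∷ x) (a ∷ y) (trans (cong (_+ hamming x y) (diff-refl a)) xy)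
  head : g (a ∷ y) ≡ g (b ∷ y)
  head with a Bool.≟ b
  ... | yes refl = refl
  ... | no  a≢b  = resp (a ∷ y) (b ∷ y) (cong₂ _+_ (diff≡1 a b a≢b) (hamming-refl y))
    where
    diff≡1 : ∀ a b → a ≢ b → diff a b ≡ 1
    diff≡1 true  true  a≢b = contradiction refl a≢b
    diff≡1 true  false _   = refl
    diff≡1 false true  _   = refl
    diff≡1 false false a≢b = contradiction refl a≢b

-- Faces as sets of vertices

infix 4 _∈ᶠ_ _∈ᶠ?_
data _∈ᶠ_ : Vertex n → Face n l → Set where
  point : [] ∈ᶠ point
  fix   : ∀ {b} {u : Vertex n} {c : Face n l} → u ∈ᶠ c → b ∷ u ∈ᶠ fix b c
  free  : ∀ {a} {u : Vertex n} {c : Face n l} → u ∈ᶠ c → a ∷ u ∈ᶠ free c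

_∈ᶠ?_ : (u : Vertex n) (c : Face n l) → Dec (u ∈ᶠ c)
[]    ∈ᶠ? point  = yes point
a ∷ u ∈ᶠ? free c = map′ free (λ { (free p) → p }) (u ∈ᶠ? c)
a ∷ u ∈ᶠ? fix b c with a Bool.≟ b
... | yes refl = map′ fix (λ { (fix p) → p }) (u ∈ᶠ? c)
... | no  a≢b  = no λ { (fix p) → a≢b refl }

embed : Face n l → Vertex l → Vertex n
embed point     x       = x
embed (fix b c) x       = b ∷ embed c x
embed (free c)  (a ∷ x) = a ∷ embed c x

embed-∈ : (c : Face n l) (x : Vertex l) → embed c x ∈ᶠ c
embed-∈ point     []      = point
embed-∈ (fix b c) x       = fix (embed-∈ c x)
embed-∈ (free c)  (a ∷ x) = free (embed-∈ c x)

∈⇒embed : {u : Vertex n} {c : Face n l} → u ∈ᶠ c → ∃ λ x → embed c x ≡ u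
∈⇒embed point    = [] , refl
∈⇒embed (fix p)  = let x , eq = ∈⇒embed p in x , cong (_ ∷_) eq
∈⇒embed (free p) = let x , eq = ∈⇒embed p in _ ∷ x , cong (_ ∷_) eq

hamming-embed : (c : Face n l) (x y : Vertex l) → hamming (embed c x) (embed c y) ≡ hamming x y
hamming-embed point     x       y       = refl
hamming-embed (fix b c) x       y       = cong₂ _+_ (diff-refl b) (hamming-embed c x y)
hamming-embed (free c)  (a ∷ x) (b ∷ y) = cong (diff a b +_) (hamming-embed c x y)

embed-injective : (c : Face n l) (x y : Vertex l) → embed c x ≡ embed c y → x ≡ y
embed-injective c x y eq = hamming-zero x y (trans (sym (hamming-embed c x y))
  (trans (cong (hamming (embed c x)) (sym eq)) (hamming-refl (embed c x))))

embed-⊙ : (c : Face n j) (d : Face j l) (x : Vertex l) → embed (c ⊙ d) x ≡ embed c (embed d x)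
embed-⊙ point     d         x       = refl
embed-⊙ (fix b c) d         x       = cong (b ∷_) (embed-⊙ c d x)
embed-⊙ (free c)  (fix b d) x       = cong (b ∷_) (embed-⊙ c d x)
embed-⊙ (free c)  (free d)  (a ∷ x) = cong (a ∷_) (embed-⊙ c d x)

vertexFace : Vertex n → Face n 0
vertexFace []      = point
vertexFace (a ∷ u) = fix a (vertexFace u)

∈-vertexFace : (u : Vertex n) → u ∈ᶠ vertexFace u
∈-vertexFace []      = point
∈-vertexFace (a ∷ u) = fix (∈-vertexFace u)

∈-vertexFace⁻ : {u v : Vertex n} → v ∈ᶠ vertexFace u → u ≡ v
∈-vertexFace⁻ {u = []}    point   = refl
∈-vertexFace⁻ {u = a ∷ u} (fix p) = cong (a ∷_) (∈-vertexFace⁻ p)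

embed-vertexFace : (u : Vertex n) → embed (vertexFace u) [] ≡ u
embed-vertexFace u = sym (∈-vertexFace⁻ (embed-∈ (vertexFace u) []))

-- At a free coordinate a face has vertices with both values, which tells it apart from a fixed one.
-- Hence distinct faces give distinct copies.
∈ᶠ-unique : {c d : Face n l} → (∀ u → u ∈ᶠ c → u ∈ᶠ d) → (∀ u → u ∈ᶠ d → u ∈ᶠ c) → c ≡ d
∈ᶠ-unique {c = point}   {point}   f g = refl
∈ᶠ-unique {c = fix a c} {fix b d} f g
  with f _ (fix (embed-∈ c (replicate _ false)))
... | fix _ = cong (fix a) (∈ᶠ-unique
  (λ u p → unfix (f (a ∷ u) (fix p))) (λ u p → unfix (g (a ∷ u) (fix p))))
  where
  unfix : ∀ {u : Vertex n} {c : Face n l} → a ∷ u ∈ᶠ fix a c → u ∈ᶠ c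
  unfix (fix p) = p
∈ᶠ-unique {c = free c} {free d} f g = cong free (∈ᶠ-unique
  (λ u p → unfree (f (true ∷ u) (free p))) (λ u p → unfree (g (true ∷ u) (free p))))
  where
  unfree : ∀ {a} {u : Vertex n} {c : Face n l} → a ∷ u ∈ᶠ free c → u ∈ᶠ c
  unfree (free p) = p
∈ᶠ-unique {c = fix true  c} {free d} f g with () ← g _ (free {a = false} (embed-∈ d (replicate _ false)))
∈ᶠ-unique {c = fix false c} {free d} f g with () ← g _ (free {a = true}  (embed-∈ d (replicate _ false)))
∈ᶠ-unique {c = free c} {fix true  d} f g with () ← f _ (free {a = false} (embed-∈ c (replicate _ false)))
∈ᶠ-unique {c = free c} {fix false d} f g with () ← f _ (free {a = true}  (embed-∈ c (replicate _ false)))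

-- When coordinate `i` is constant on `c`, freeing it yields the union of `c` and its translate
-- along `i`.
record Extension (i : Fin n) (c : Face n l) : Set where
  field
    face    : Face n (suc l)
    old     : ∀ {v} → v ∈ᶠ c → v ∈ᶠ face
    new     : ∀ {v} → v ∈ᶠ c → flip i v ∈ᶠ face
    nothing-else : ∀ {v} → v ∈ᶠ face → v ∈ᶠ c ⊎ flip i v ∈ᶠ c
    fixed   : ∀ {u v} → u ∈ᶠ c → v ∈ᶠ c → lookup u i ≡ lookup v i

extend : ∀ i (c : Face n l) → (∀ {v} → v ∈ᶠ c → flip i v ∈ᶠ c) ⊎ Extension i c
extend zero (free c)  = inj₁ λ { (free p) → free p }
extend zero (fix b c) = inj₂ record
  { face = free c
  ; old  = λ { (fix p) → free p }
  ; new  = λ { (fix p) → free p }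
  ; nothing-else = λ { {a ∷ v} (free p) → side a b p }
  ; fixed = λ { (fix _) (fix _) → refl }
  }
  where
  side : ∀ a b {v} {c : Face n l} → v ∈ᶠ c → a ∷ v ∈ᶠ fix b c ⊎ not a ∷ v ∈ᶠ fix b c
  side true  true  p = inj₁ (fix p)
  side false false p = inj₁ (fix p)
  side true  false p = inj₂ (fix p)
  side false true  p = inj₂ (fix p)
extend (suc i) (fix b c) with extend i c
... | inj₁ closed = inj₁ λ { (fix p) → fix (closed p) }
... | inj₂ ext = inj₂ record
  { face = fix b face
  ; old  = λ { (fix p) → fix (old p) }
  ; new  = λ { (fix p) → fix (new p) }
  ; nothing-else = λ { (fix p) → Sum.map fix fix (nothing-else p) }
  ; fixed = λ { (fix p) (fix q) → fixed p q }
  }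
  where open Extension ext
extend (suc i) (free c) with extend i c
... | inj₁ closed = inj₁ λ { (free p) → free (closed p) }
... | inj₂ ext = inj₂ record
  { face = free face
  ; old  = λ { (free p) → free (old p) }
  ; new  = λ { (free p) → free (new p) }
  ; nothing-else = λ { (free p) → Sum.map free free (nothing-else p) }
  ; fixed = λ { (free p) (free q) → fixed p q }
  }
  where open Extension ext

-- Isometry is recorded because `IsoCube⇒face` pulls adjacent vertices of the face back to adjacent
-- vertices of the smaller cube.
record Spans (f : Vertex l → Vertex n) (c : Face n l) : Set where
  field
    inside    : ∀ x → f x ∈ᶠ c
    onto      : ∀ {v} → v ∈ᶠ c → ∃ λ x → f x ≡ v
    isometric : ∀ x y → hamming (f x) (f y) ≡ hamming x y

-- The two halves of the cube are mapped to translates of each other along one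
-- coordinate, because opposite edges of a 4-cycle are parallel.
rigidity : ∀ l (f : Vertex l → Vertex n) → (∀ x y → f x ≡ f y → x ≡ y) →
           (∀ x y → Adj x y → Adj (f x) (f y)) → ∃ (Spans f)
rigidity zero f inj hom = vertexFace (f []) , record
  { inside    = λ { [] → ∈-vertexFace (f []) }
  ; onto      = λ p → [] , ∈-vertexFace⁻ p
  ; isometric = λ { [] [] → hamming-refl (f []) }
  }
rigidity {n} (suc l) f inj hom with rigidity l f₀ (λ x y eq → tail-eq (inj _ _ eq)) (λ x y → hom (false ∷ x) (false ∷ y))
  where
  f₀ : Vertex l → Vertex n
  f₀ x = f (false ∷ x)
  tail-eq : ∀ {x y : Vertex l} → false ∷ x ≡ false ∷ y → x ≡ y
  tail-eq refl = refl
... | c , spans = result (extend direction c)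
  where
  open Spans spans
  f₀ f₁ : Vertex l → Vertex n
  f₀ x = f (false ∷ x)
  f₁ x = f (true ∷ x)
  step : ∀ x → ∃ λ i → f₁ x ≡ flip i (f₀ x)
  step x = Adj⇒flip (f₀ x) (f₁ x) (hom (false ∷ x) (true ∷ x) (cong suc (hamming-refl x)))
  f₁≢f₀ : ∀ x y → f₁ x ≢ f₀ y
  f₁≢f₀ x y eq with () ← inj (true ∷ x) (false ∷ y) eq
  step-constant : ∀ x y → Adj x y → proj₁ (step x) ≡ proj₁ (step y)
  -- The 4-cycle is `f₀ x`, `f₀ y`, `f₁ y`, `f₁ x`; its edges between the two halves have the
  -- directions `a` and `b`.
  step-constant x y xy with step x | step y | Adj⇒flip (f₀ x) (f₀ y) (hom (false ∷ x) (false ∷ y) xy)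
  ... | a , eqx | b , eqy | i , eq = sym (parallel (f₀ x)
    (subst₂ Adj eqx f₁y≡ (hom (true ∷ x) (true ∷ y) xy))
    (λ e → f₁≢f₀ x y (trans eqx (trans e (sym eq))))
    (λ e → f₁≢f₀ y x (trans f₁y≡ e)))
    where
    f₁y≡ : f₁ y ≡ flip b (flip i (f₀ x))
    f₁y≡ = trans eqy (cong (flip b) eq)
  direction : Fin n
  direction = proj₁ (step (replicate l false))
  f₁≡ : ∀ x → f₁ x ≡ flip direction (f₀ x)
  f₁≡ x = trans (proj₂ (step x))
    (cong (λ i → flip i (f₀ x)) (constant-on-cube (proj₁ ∘ step) step-constant x (replicate l false)))
  result : (∀ {v} → v ∈ᶠ c → flip direction v ∈ᶠ c) ⊎ Extension direction c → ∃ (Spans f)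
  -- If `c` contained its own translate, then `f₁` would share a value with `f₀`, against
  -- injectivity.
  result (inj₁ closed) with onto (closed (inside (replicate l false)))
  ... | x , eq = contradiction (trans (f₁≡ (replicate l false)) (sym eq)) (f₁≢f₀ (replicate l false) x)
  result (inj₂ ext) = face , record
    { inside    = λ { (false ∷ x) → old (inside x)
                    ; (true ∷ x)  → subst (_∈ᶠ face) (sym (f₁≡ x)) (new (inside x)) }
    ; onto      = λ p → preimage (nothing-else p)
    ; isometric = λ { (false ∷ x) (false ∷ y) → isometric x y
                    ; (true ∷ x)  (true ∷ y)  → trans (cong₂ hamming (f₁≡ x) (f₁≡ y))
                        (trans (hamming-flip-flip direction (f₀ x) (f₀ y)) (isometric x y))
                    ; (false ∷ x) (true ∷ y)  → across x y
                    ; (true ∷ x)  (false ∷ y) → trans (hamming-sym (f₁ x) (f₀ y))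
                        (trans (across y x) (cong suc (hamming-sym y x))) }
    }
    where
    open Extension ext
    preimage : ∀ {v} → v ∈ᶠ c ⊎ flip direction v ∈ᶠ c → ∃ λ x → f x ≡ v
    preimage     (inj₁ p) = let x , eq = onto p in false ∷ x , eq
    preimage {v} (inj₂ p) = let x , eq = onto p in true ∷ x ,
      trans (f₁≡ x) (trans (cong (flip direction) eq) (flip-involutive direction v))
    across : ∀ x y → hamming (f₀ x) (f₁ y) ≡ suc (hamming x y)
    across x y = trans (cong (hamming (f₀ x)) (f₁≡ y))
      (trans (hamming-flip direction (f₀ x) (f₀ y) (fixed (inside x) (inside y))) (cong suc (isometric x y)))

-- Counting copies in subgraphs

≈-sym : {G H : Subgraph n} → G ≈ H → H ≈ G
≈-sym (v , e) = (λ u → sym (v u)) , λ u w → sym (e u w)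

≈-trans : {G H K : Subgraph n} → G ≈ H → H ≈ K → G ≈ K
≈-trans (v , e) (v′ , e′) = (λ u → trans (v u) (v′ u)) , λ u w → trans (e u w) (e′ u w)

≈⇒⊇ : {G H : Subgraph n} → G ≈ H → H ⊆ G
≈⇒⊇ (v , e) = (λ u → trans (v u)) , λ u w → trans (e u w)

⊆-trans : {G H K : Subgraph n} → G ⊆ H → H ⊆ K → G ⊆ K
⊆-trans (v , e) (v′ , e′) = (λ u → v′ u ∘ v u) , λ u w → e′ u w ∘ e u w

adj-sym : (u v : Vertex n) → adj u v ≡ adj v u
adj-sym u v = cong (_≡ᵇ 1) (hamming-sym u v)

faceGraph : Face n l → Subgraph n
faceGraph c = record
  { V     = λ u → does (u ∈ᶠ? c)
  ; E     = λ u v → does (u ∈ᶠ? c) ∧ (does (v ∈ᶠ? c) ∧ adj u v)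
  ; E-sym = λ u v → symmetric (does (u ∈ᶠ? c)) (does (v ∈ᶠ? c)) (adj-sym u v)
  ; E-adj = λ u v e → adj⇒Adj u v (proj₂ (∧-true⁻ {does (v ∈ᶠ? c)} (proj₂ (∧-true⁻ {does (u ∈ᶠ? c)} e))))
  ; E-V   = λ u v e → proj₁ (∧-true⁻ e)
  }
  where
  symmetric : ∀ a b {x y} → x ≡ y → a ∧ (b ∧ x) ≡ b ∧ (a ∧ y)
  symmetric true  true  eq = eq
  symmetric true  false eq = refl
  symmetric false true  eq = refl
  symmetric false false eq = refl

faceGraph-E : (c : Face n l) {u v : Vertex n} → u ∈ᶠ c → v ∈ᶠ c → E (faceGraph c) u v ≡ adj u v
faceGraph-E c {u} {v} p q = cong₂ (λ a b → a ∧ (b ∧ adj u v)) (dec-true (u ∈ᶠ? c) p) (dec-true (v ∈ᶠ? c) q)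

faceGraph-IsoCube : (c : Face n l) → IsoCube l (faceGraph c)
faceGraph-IsoCube c = embed c , embed-injective c , (λ x → dec-true (embed c x ∈ᶠ? c) (embed-∈ c x)) ,
  (λ v v∈ → ∈⇒embed (does-true⁻ (v ∈ᶠ? c) v∈)) ,
  λ x y → trans (faceGraph-E c (embed-∈ c x) (embed-∈ c y)) (cong (_≡ᵇ 1) (hamming-embed c x y))

faceGraph-injective : (c d : Face n l) → faceGraph c ≈ faceGraph d → c ≡ d
faceGraph-injective c d (same , _) = ∈ᶠ-unique
  (λ u p → does-true⁻ (u ∈ᶠ? d) (trans (sym (same u)) (dec-true (u ∈ᶠ? c) p)))
  (λ u p → does-true⁻ (u ∈ᶠ? c) (trans (same u) (dec-true (u ∈ᶠ? d) p)))

-- `rigidity` identifies the vertex set of `H`. An adjacent pair in the face comes by isometry from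
-- an adjacent pair of Q_l, which the isomorphism sends to an edge of `H`; so no edge of the face is
-- absent.
IsoCube⇒face : (H : Subgraph n) → IsoCube l H → ∃ λ (c : Face n l) → H ≈ faceGraph c
IsoCube⇒face {n} {l} H (f , inj , fV , surj , fE)
  with rigidity l f inj (λ x y xy → E-adj H (f x) (f y) (trans (fE x y) (Adj⇒adj x y xy)))
... | c , spans = c , vertices , λ u v → bool-ext (forward u v) (backward u v)
  where
  open Spans spans
  V⇒∈ : ∀ u → V H u ≡ true → u ∈ᶠ c
  V⇒∈ u u∈ = let x , eq = surj u u∈ in subst (_∈ᶠ c) eq (inside x)
  vertices : ∀ u → V H u ≡ does (u ∈ᶠ? c)
  vertices u = bool-ext (λ u∈ → dec-true (u ∈ᶠ? c) (V⇒∈ u u∈))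
    (λ u∈ → let x , eq = onto (does-true⁻ (u ∈ᶠ? c) u∈) in subst (λ w → V H w ≡ true) eq (fV x))
  forward : ∀ u v → E H u v ≡ true → E (faceGraph c) u v ≡ true
  forward u v e = trans
    (faceGraph-E c (V⇒∈ u (E-V H u v e)) (V⇒∈ v (E-V H v u (trans (E-sym H v u) e))))
    (Adj⇒adj u v (E-adj H u v e))
  backward : ∀ u v → E (faceGraph c) u v ≡ true → E H u v ≡ true
  backward u v e with onto (does-true⁻ (u ∈ᶠ? c) (proj₁ (∧-true⁻ e)))
                    | onto (does-true⁻ (v ∈ᶠ? c) (proj₁ (∧-true⁻ (proj₂ (∧-true⁻ {does (u ∈ᶠ? c)} e)))))
  ... | x , refl | y , refl = trans (fE x y)
    (Adj⇒adj x y (trans (sym (isometric x y)) (E-adj (faceGraph c) (f x) (f y) e)))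

end : Bool → Face n 1 → Vertex n
end b e = embed e (b ∷ [])

end-Adj : (e : Face n 1) → Adj (end false e) (end true e)
end-Adj e = hamming-embed e (false ∷ []) (true ∷ [])

Adj⇒edge : (u v : Vertex n) → Adj u v → ∃ λ e →
           (u ≡ end false e × v ≡ end true e) ⊎ (u ≡ end true e × v ≡ end false e)
Adj⇒edge []          []          ()
Adj⇒edge (true  ∷ u) (true  ∷ v) uv with Adj⇒edge u v uv
... | e , inj₁ (p , q) = fix true e , inj₁ (cong (true ∷_) p , cong (true ∷_) q)
... | e , inj₂ (p , q) = fix true e , inj₂ (cong (true ∷_) p , cong (true ∷_) q)
Adj⇒edge (false ∷ u) (false ∷ v) uv with Adj⇒edge u v uv
... | e , inj₁ (p , q) = fix false e , inj₁ (cong (false ∷_) p , cong (false ∷_) q)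
... | e , inj₂ (p , q) = fix false e , inj₂ (cong (false ∷_) p , cong (false ∷_) q)
Adj⇒edge (true  ∷ u) (false ∷ v) uv with hamming-zero u v (suc-injective uv)
... | refl = free (vertexFace u) , inj₂ (cong (true ∷_) eq , cong (false ∷_) eq)
  where eq = sym (embed-vertexFace u)
Adj⇒edge (false ∷ u) (true  ∷ v) uv with hamming-zero u v (suc-injective uv)
... | refl = free (vertexFace u) , inj₁ (cong (false ∷_) eq , cong (true ∷_) eq)
  where eq = sym (embed-vertexFace u)

edgesOf : Subgraph n → EdgeSet n
edgesOf G e = E G (end false e) (end true e)

-- `edgesOf` forgets the vertex set of `G`. For l ≥ 1 every vertex of the face is an end of one of
-- its edges, so the edges bring the vertices along.
Intact⇒⊆ : (G : Subgraph n) (c : Face n l) → 1 ≤ l → Intact (edgesOf G) c → faceGraph c ⊆ G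
Intact⇒⊆ {n} {l} G c 1≤l intact = vertices 1≤l , edges
  where
  edge : ∀ x y → Adj x y → E G (embed c x) (embed c y) ≡ true
  edge x y xy with Adj⇒edge x y xy
  ... | e , inj₁ (refl , refl) = subst₂ (λ u v → E G u v ≡ true)
    (embed-⊙ c e (false ∷ [])) (embed-⊙ c e (true ∷ [])) (intact e)
  ... | e , inj₂ (refl , refl) = trans (E-sym G _ _) (subst₂ (λ u v → E G u v ≡ true)
    (embed-⊙ c e (false ∷ [])) (embed-⊙ c e (true ∷ [])) (intact e))
  vertices : 1 ≤ l → ∀ u → does (u ∈ᶠ? c) ≡ true → V G u ≡ true
  vertices (s≤s _) u u∈ with ∈⇒embed (does-true⁻ (u ∈ᶠ? c) u∈)
  ... | x , refl = E-V G _ _ (edge x (flip zero x) (hamming-flip-one zero x))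
  edges : ∀ u v → E (faceGraph c) u v ≡ true → E G u v ≡ true
  edges u v e with ∈⇒embed (does-true⁻ (u ∈ᶠ? c) (proj₁ (∧-true⁻ e)))
                 | ∈⇒embed (does-true⁻ (v ∈ᶠ? c) (proj₁ (∧-true⁻ (proj₂ (∧-true⁻ {does (u ∈ᶠ? c)} e)))))
  ... | x , refl | y , refl =
    edge x y (trans (sym (hamming-embed c x y)) (E-adj (faceGraph c) (embed c x) (embed c y) e))

⊆⇒Intact : (G : Subgraph n) (c : Face n l) → faceGraph c ⊆ G → Intact (edgesOf G) c
⊆⇒Intact G c (_ , edges) e = subst₂ (λ u v → E G u v ≡ true)
  (sym (embed-⊙ c e (false ∷ []))) (sym (embed-⊙ c e (true ∷ [])))
  (edges u v (trans (faceGraph-E c (embed-∈ c (end false e)) (embed-∈ c (end true e)))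
    (Adj⇒adj u v (trans (hamming-embed c (end false e) (end true e)) (end-Adj e)))))
  where
  u = embed c (end false e)
  v = embed c (end true e)

Free⇒FaceFree : (G : Subgraph n) → 1 ≤ k → Free k G → FaceFree k (edgesOf G)
Free⇒FaceFree G 1≤k k-free c intact =
  k-free (faceGraph c) (Intact⇒⊆ G c 1≤k intact) (faceGraph-IsoCube c)

FaceFree⇒Free : (G : Subgraph n) → FaceFree k (edgesOf G) → Free k G
FaceFree⇒Free G k-free H H⊆G iso with IsoCube⇒face H iso
... | c , H≈c = k-free c (⊆⇒Intact G c (⊆-trans {G = faceGraph c} {H} {G} (≈⇒⊇ {G = H} {faceGraph c} H≈c) H⊆G))

fix-injective : ∀ {b} {c d : Face n l} → fix b c ≡ fix b d → c ≡ d
fix-injective refl = refl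

free-injective : {c d : Face n l} → free c ≡ free d → c ≡ d
free-injective refl = refl

maps-disjoint : ∀ {X Y Z : Set} {f : X → Z} {g : Y → Z} {xs ys z} →
                (∀ x y → f x ≢ g y) → ¬ (z ∈ map f xs × z ∈ map g ys)
maps-disjoint {f = f} {g} f≢g (p , q) with ∈-map⁻ f p | ∈-map⁻ g q
... | x , _ , eq | y , _ , eq′ = f≢g x y (trans (sym eq) eq′)

faces-unique : ∀ n l → Unique (faces n l)
faces-unique zero    zero    = [] ∷ []
faces-unique zero    (suc l) = []
faces-unique (suc n) zero    = ++⁺ (map⁺ fix-injective (faces-unique n 0)) (map⁺ fix-injective (faces-unique n 0))
  (maps-disjoint λ _ _ ())
faces-unique (suc n) (suc l) = ++⁺
  (++⁺ (map⁺ fix-injective (faces-unique n (suc l))) (map⁺ fix-injective (faces-unique n (suc l))) (maps-disjoint λ _ _ ()))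
  (map⁺ free-injective (faces-unique n l))
  λ { (p , q) → case (∈-++⁻ (map (fix true) (faces n (suc l))) p) q }
  where
  case : ∀ {z} → z ∈ map (fix true) (faces n (suc l)) ⊎ z ∈ map (fix false) (faces n (suc l)) →
         ¬ z ∈ map free (faces n l)
  case (inj₁ p) q = maps-disjoint (λ _ _ ()) (p , q)
  case (inj₂ p) q = maps-disjoint (λ _ _ ()) (p , q)

lookup-unique : {xs : List X} → Unique xs → ∀ i j → List.lookup xs i ≡ List.lookup xs j → i ≡ j
lookup-unique (x∉ ∷ u) zero    zero    eq = refl
lookup-unique {xs = x ∷ xs} (x∉ ∷ u) zero    (suc j) eq = contradiction eq (All.lookup x∉ (∈-lookup j))
lookup-unique {xs = x ∷ xs} (x∉ ∷ u) (suc i) zero    eq = contradiction (sym eq) (All.lookup x∉ (∈-lookup i))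
lookup-unique (x∉ ∷ u) (suc i) (suc j) eq = cong suc (lookup-unique u i j eq)

-- Up to `≈`, the copies of Q_l in `G` are the graphs of its intact l-faces, and distinct faces have
-- distinct graphs.
intact-copies : (G : Subgraph n) → 1 ≤ l → NumCopies l G (#intact l (edgesOf G))
intact-copies {n} {l} G 1≤l = subst (NumCopies l G) size
  ( faceGraph ∘ List.lookup copies
  , (λ i → Intact⇒⊆ G _ 1≤l (proj₂ (∈-filter⁻ copy? {xs = faces n l} (∈-lookup i))) , faceGraph-IsoCube _)
  , (λ i j eq → lookup-unique (filter⁺ copy? (faces-unique n l)) i j (faceGraph-injective _ _ eq))
  , covered )
  where
  copy? : (c : Face n l) → Dec (Intact (edgesOf G) c)
  copy? = intact? (edgesOf G)
  copies : List (Face n l)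
  copies = filter copy? (faces n l)
  size : length copies ≡ #intact l (edgesOf G)
  size = trans (length-filter≡sum copy? (faces n l)) (sym (∑-def _))
  covered : ∀ H → CopyOf l G H → ∃ λ i → H ≈ faceGraph (List.lookup copies i)
  covered H (H⊆G , iso) with IsoCube⇒face H iso
  ... | c , H≈c = index c∈ , subst (λ d → H ≈ faceGraph d) (lookup-index c∈) H≈c
    where
    c∈ : c ∈ copies
    c∈ = ∈-filter⁺ copy? (∈-faces c)
      (⊆⇒Intact G c (⊆-trans {G = faceGraph c} {H} {G} (≈⇒⊇ {G = H} {faceGraph c} H≈c) H⊆G))

-- Matching each graph enumerated by `g` with one enumerated by `h` is injective, since `g` has no
-- repetitions. Thus any count allowed in `IsEx` can be compared with the number of intact faces.
HasCount-≤ : {P : Subgraph n → Set} {a b : ℕ} → HasCount P a → HasCount P b → a ≤ b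
HasCount-≤ {a = a} {b} (g , Pg , g-inj , _) (h , _ , _ , h-covers) = injective⇒≤ {f = position} λ {i} {j} eq →
  g-inj i j (≈-trans {G = g i} {h (position i)} {g j} (proj₂ (h-covers (g i) (Pg i)))
    (subst (λ p → h p ≈ g j) (sym eq) (≈-sym {G = g j} {h (position j)} (proj₂ (h-covers (g j) (Pg j))))))
  where
  position : Fin a → Fin b
  position i = proj₁ (h-covers (g i) (Pg i))

-- Graphs from edge sets and the extremal edge set

joins : EdgeSet n → Vertex n → Vertex n → Bool
joins p []          []          = false
joins p (true  ∷ u) (true  ∷ v) = joins (p ∘ fix true) u v
joins p (false ∷ u) (false ∷ v) = joins (p ∘ fix false) u v
-- The pair already differs in this coordinate, so it is an edge only if the tails agree.
joins p (true  ∷ u) (false ∷ v) = does (≡-dec Bool._≟_ u v) ∧ p (free (vertexFace u))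
joins p (false ∷ u) (true  ∷ v) = does (≡-dec Bool._≟_ u v) ∧ p (free (vertexFace u))

joins-swap : (q : Face n 0 → Bool) (u v : Vertex n) →
  does (≡-dec Bool._≟_ u v) ∧ q (vertexFace u) ≡ does (≡-dec Bool._≟_ v u) ∧ q (vertexFace v)
joins-swap q u v with ≡-dec Bool._≟_ u v | ≡-dec Bool._≟_ v u
... | yes refl | yes _   = refl
... | yes refl | no  u≢u = contradiction refl u≢u
... | no  u≢u  | yes refl = contradiction refl u≢u
... | no  _    | no  _   = refl

joins-sym : (p : EdgeSet n) (u v : Vertex n) → joins p u v ≡ joins p v u
joins-sym p []          []          = refl
joins-sym p (true  ∷ u) (true  ∷ v) = joins-sym (p ∘ fix true) u v
joins-sym p (false ∷ u) (false ∷ v) = joins-sym (p ∘ fix false) u v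
joins-sym p (true  ∷ u) (false ∷ v) = joins-swap (p ∘ free) u v
joins-sym p (false ∷ u) (true  ∷ v) = joins-swap (p ∘ free) u v

joins-Adj : (p : EdgeSet n) (u v : Vertex n) → joins p u v ≡ true → Adj u v
joins-Adj p []          []          ()
joins-Adj p (true  ∷ u) (true  ∷ v) e = joins-Adj (p ∘ fix true) u v e
joins-Adj p (false ∷ u) (false ∷ v) e = joins-Adj (p ∘ fix false) u v e
joins-Adj p (true  ∷ u) (false ∷ v) e with does-true⁻ (≡-dec Bool._≟_ u v) (proj₁ (∧-true⁻ e))
... | refl = cong suc (hamming-refl u)
joins-Adj p (false ∷ u) (true  ∷ v) e with does-true⁻ (≡-dec Bool._≟_ u v) (proj₁ (∧-true⁻ e))
... | refl = cong suc (hamming-refl u)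

graphOf : EdgeSet n → Subgraph n
graphOf p = record
  { V     = λ _ → true
  ; E     = joins p
  ; E-sym = joins-sym p
  ; E-adj = joins-Adj p
  ; E-V   = λ _ _ _ → refl
  }

vertexFace-embed : (c : Face n 0) → vertexFace (embed c []) ≡ c
vertexFace-embed point     = refl
vertexFace-embed (fix b c) = cong (fix b) (vertexFace-embed c)

edgesOf-graphOf : (p : EdgeSet n) (e : Face n 1) → edgesOf (graphOf p) e ≡ p e
edgesOf-graphOf p (fix true  e) = edgesOf-graphOf (p ∘ fix true) e
edgesOf-graphOf p (fix false e) = edgesOf-graphOf (p ∘ fix false) e
edgesOf-graphOf p (free c) = cong₂ _∧_ (dec-true (≡-dec Bool._≟_ (embed c []) (embed c [])) refl)
  (cong (p ∘ free) (vertexFace-embed c))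

FaceFree-resp : {p q : EdgeSet n} → (∀ e → p e ≡ q e) → FaceFree k p → FaceFree k q
FaceFree-resp p≗q k-free c intact = k-free c (λ e → trans (p≗q (c ⊙ e)) (intact e))

indicator-⇔ : {P R : Set} (P? : Dec P) (R? : Dec R) → (P → R) → (R → P) → indicator P? ≡ indicator R?
indicator-⇔ (yes _) (yes _) f g = refl
indicator-⇔ (yes p) (no ¬r) f g = contradiction (f p) ¬r
indicator-⇔ (no ¬p) (yes r) f g = contradiction (g r) ¬p
indicator-⇔ (no _)  (no _)  f g = refl

#intact-cong : ∀ l {p q : EdgeSet n} → (∀ e → p e ≡ q e) → #intact l p ≡ #intact l q
#intact-cong l {p} {q} p≗q = ∑-cong λ c → indicator-⇔ (intact? p c) (intact? q c)
  (λ intact e → trans (sym (p≗q (c ⊙ e))) (intact e)) (λ intact e → trans (p≗q (c ⊙ e)) (intact e))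

maximizer : ∀ {m} (F : Vec Bool m → ℕ) → ∃ λ v → ∀ u → F u ≤ F v
maximizer {zero}  F = [] , λ { [] → ≤-refl }
maximizer {suc m} F with maximizer (F ∘ (true ∷_)) | maximizer (F ∘ (false ∷_))
... | v , v-max | w , w-max with F (true ∷ v) ≤? F (false ∷ w)
...   | yes v≤w = false ∷ w , λ { (true ∷ u) → ≤-trans (v-max u) v≤w ; (false ∷ u) → w-max u }
...   | no  v≰w = true ∷ v , λ { (true ∷ u) → v-max u ; (false ∷ u) → ≤-trans (w-max u) (≰⇒≥ v≰w) }

-- An edge set is coded by a bit vector along the list of edges, so that `maximizer` can search all
-- of them.
extremal : ∀ n k l → 1 ≤ k → ∃ λ (p : EdgeSet n) →
           FaceFree k p × (∀ q → FaceFree k q → #intact l q ≤ #intact l p)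
extremal n k l 1≤k = guard (decode best) , guard-free (decode best) , bound
  where
  Code = Vec Bool (length (faces n 1))
  decode : Code → EdgeSet n
  decode v e = lookup v (index (∈-faces e))
  encode : EdgeSet n → Code
  encode q = tabulate (q ∘ List.lookup (faces n 1))
  decode-encode : ∀ q e → q e ≡ decode (encode q) e
  decode-encode q e = trans (cong q (lookup-index (∈-faces e)))
    (sym (lookup∘tabulate (q ∘ List.lookup (faces n 1)) (index (∈-faces e))))
  free? : (p : EdgeSet n) → Dec (FaceFree k p)
  free? p = all-faces? (λ c → ¬? (intact? p c))
  none : EdgeSet n
  none _ = false
  none-free : FaceFree k none
  none-free c intact with () ← intact (proj₁ (edge-with-ones 1≤k))
  -- An edge set with an intact k-face is replaced by the empty one, which is admissible because k ≥
  -- 1 gives every k-face an edge. Maximising over all codes then maximises over the admissible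
  -- sets.
  guard : EdgeSet n → EdgeSet n
  guard p with free? p
  ... | yes _ = p
  ... | no  _ = none
  guard-free : ∀ p → FaceFree k (guard p)
  guard-free p with free? p
  ... | yes k-free = k-free
  ... | no  _      = none-free
  guard-id : ∀ p → FaceFree k p → guard p ≡ p
  guard-id p k-free with free? p
  ... | yes _ = refl
  ... | no ¬f = contradiction k-free ¬f
  best : Code
  best = proj₁ (maximizer (#intact l ∘ guard ∘ decode))
  bound : ∀ q → FaceFree k q → #intact l q ≤ #intact l (guard (decode best))
  bound q k-free = begin
    #intact l q                             ≡⟨ #intact-cong l (decode-encode q) ⟩
    #intact l (decode (encode q))           ≡⟨ cong (#intact l) (guard-id _ (FaceFree-resp (decode-encode q) k-free)) ⟨
    #intact l (guard (decode (encode q)))   ≤⟨ proj₂ (maximizer (#intact l ∘ guard ∘ decode)) (encode q) ⟩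
    #intact l (guard (decode best))         ∎
    where open ≤-Reasoning

extremal-IsEx : ∀ {n k l} (p : EdgeSet n) → 1 ≤ k → 1 ≤ l → FaceFree k p →
                (∀ q → FaceFree k q → #intact l q ≤ #intact l p) → IsEx n l k (#intact l p)
extremal-IsEx {l = l} p 1≤k 1≤l k-free maximal =
  ( graphOf p
  , FaceFree⇒Free (graphOf p) (FaceFree-resp (λ e → sym (edgesOf-graphOf p e)) k-free)
  , subst (NumCopies l (graphOf p)) (#intact-cong l (edgesOf-graphOf p)) (intact-copies (graphOf p) 1≤l) ) ,
  λ G c G-free copies → ≤-trans (HasCount-≤ copies (intact-copies G 1≤l))
    (maximal (edgesOf G) (Free⇒FaceFree G 1≤k G-free))

copies-in-Q : ∀ n l → 1 ≤ l → NumCopies l (Q n) (#faces n l)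
copies-in-Q n l 1≤l = subst (NumCopies l (Q n))
  (∑-cong λ c → indicator-yes (intact? (edgesOf (Q n)) c)
    (λ e → Adj⇒adj (end false (c ⊙ e)) (end true (c ⊙ e)) (end-Adj (c ⊙ e))))
  (intact-copies (Q n) 1≤l)

-- The four density bounds

dense-bound : ∀ {l} P w {m} (p : EdgeSet n) → P * #broken l p ≤ w * #faces n l → #intact l p ≤ m →
              P * #faces n l ≤ w * #faces n l + P * m
dense-bound {n} {l} P w {m} p sparse I≤m = begin
  P * #faces n l                      ≡⟨ cong (P *_) (#intact+#broken l p) ⟨
  P * (#intact l p + #broken l p)     ≡⟨ *-distribˡ-+ P (#intact l p) (#broken l p) ⟩
  P * #intact l p + P * #broken l p   ≤⟨ +-mono-≤ (*-monoʳ-≤ P I≤m) sparse ⟩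
  P * m + w * #faces n l              ≡⟨ +-comm (P * m) _ ⟩
  w * #faces n l + P * m              ∎
  where open ≤-Reasoning

^-*-monoˡ : ∀ {k} t N → k ≤ 2 ^ t → k ^ N ≤ 2 ^ (t * N)
^-*-monoˡ t N k≤ = ≤-trans (^-monoˡ-≤ N k≤) (≤-reflexive (^-*-assoc 2 t N))

module DensityBounds {n k l : ℕ} where
  N = #faces n l

  level-bound : ∀ {m} → (∀ (p : EdgeSet n) → FaceFree k p → #intact l p ≤ m) → 1 ≤ k → k * N ≤ l * N + k * m
  level-bound maximal 1≤k with sparse-by-level n k l 1≤k
  ... | p , k-free , sparse = dense-bound k l p sparse (maximal p k-free)

  profile-bound : ∀ {m} → (∀ (p : EdgeSet n) → FaceFree k p → #intact l p ≤ m) → 1 ≤ k →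
    k * (k + 2) * N ≤ 4 * ((l + 2) C 3) * N + k * (k + 2) * m
  profile-bound {m} maximal 1≤k with balanced-split k 1≤k
  ... | s , t , refl , split with sparse-by-profile n s t l
  ...   | p , k-free , sparse = dense-bound (k * (k + 2)) (4 * ((l + 2) C 3)) p (begin
    -- The product of the moduli depends on the parity of k; the bound k (k + 2) / 4 serves both
    -- parities.
    k * (k + 2) * #broken l p             ≤⟨ *-monoˡ-≤ (#broken l p) split ⟩
    4 * (suc s * suc t) * #broken l p     ≡⟨ *-assoc 4 (suc s * suc t) (#broken l p) ⟩
    4 * (suc s * suc t * #broken l p)     ≤⟨ *-monoʳ-≤ 4 sparse ⟩
    4 * (((2 + l) C 3) * N)               ≡⟨ *-assoc 4 ((2 + l) C 3) N ⟨
    4 * ((2 + l) C 3) * N                 ≡⟨ cong (λ x → 4 * (x C 3) * N) (+-comm 2 l) ⟩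
    4 * ((l + 2) C 3) * N                 ∎) (maximal p k-free)
    where open ≤-Reasoning

  module _ (p : EdgeSet n) (k-free : FaceFree k p) where
    m = #intact l p
    B = #broken l p
    open ≤-Reasoning

    -- This is `broken-upper` doubled, as twice the number of edges of Q_k is k 2 ^ k.
    local-bound : 1 ≤ k → l ≤ k → k ≤ n → k * 2 ^ k * m + l * 2 ^ l * N ≤ k * 2 ^ k * N
    local-bound 1≤k l≤k k≤n = begin
      k * 2 ^ k * m + l * 2 ^ l * N          ≡⟨ cong (λ x → k * 2 ^ k * m + x * N) (#faces-edge l) ⟨
      k * 2 ^ k * m + 2 * #faces l 1 * N     ≡⟨ cong (k * 2 ^ k * m +_) (*-assoc 2 (#faces l 1) N) ⟩
      k * 2 ^ k * m + 2 * (#faces l 1 * N)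
        ≤⟨ +-monoʳ-≤ (k * 2 ^ k * m) (*-monoʳ-≤ 2 (broken-upper p k-free 1≤k l≤k k≤n)) ⟩
      k * 2 ^ k * m + 2 * (B * #faces k 1)   ≡⟨ cong (k * 2 ^ k * m +_) (shuffle B (#faces k 1)) ⟩
      k * 2 ^ k * m + 2 * #faces k 1 * B     ≡⟨ cong (λ x → k * 2 ^ k * m + x * B) (#faces-edge k) ⟩
      k * 2 ^ k * m + k * 2 ^ k * B          ≡⟨ *-distribˡ-+ (k * 2 ^ k) m B ⟨
      k * 2 ^ k * (m + B)                    ≡⟨ cong (k * 2 ^ k *_) (#intact+#broken l p) ⟩
      k * 2 ^ k * N                          ∎
      where
      shuffle : ∀ x y → 2 * (x * y) ≡ 2 * y * x
      shuffle = solve-∀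

    -- Passing to dimension k + 2 multiplies 2 ^ k by 4, and k + 2 ≤ 2 k; halving for edges leaves
    -- the factor 4 that becomes the constant of the theorem.
    edges-bound : 2 ≤ k → #faces (2 + k) 1 ≤ 4 * (k * 2 ^ k)
    edges-bound 2≤k = *-cancelˡ-≤ 2 (begin
      2 * #faces (2 + k) 1          ≡⟨ #faces-edge (2 + k) ⟩
      (2 + k) * (2 * (2 * 2 ^ k))   ≤⟨ *-monoˡ-≤ (2 * (2 * 2 ^ k)) (+-monoˡ-≤ k 2≤k) ⟩
      (k + k) * (2 * (2 * 2 ^ k))   ≡⟨ shuffle k (2 ^ k) ⟩
      2 * (4 * (k * 2 ^ k))         ∎)
      where
      shuffle : ∀ k x → (k + k) * (2 * (2 * x)) ≡ 2 * (4 * (k * x))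
      shuffle = solve-∀

    -- Taking binary logarithms and dividing by 4 N k 2 ^ k gives m / N ≤ 1 - log₂ k / (4 k 2 ^ k);
    -- the exponential form stays within the natural numbers.
    log-bound : 1 ≤ l → 2 ≤ k → l ≤ n → 2 + k ≤ n →
                k ^ N * 2 ^ (4 * m * (k * 2 ^ k)) ≤ 2 ^ (4 * N * (k * 2 ^ k))
    log-bound 1≤l 2≤k l≤n 2+k≤n with least-power (2 + k)
    ... | t , 2+k≤2^t , least = begin
      k ^ N * 2 ^ (4 * m * K)          ≤⟨ *-monoˡ-≤ (2 ^ (4 * m * K)) (^-*-monoˡ t N (≤-trans (m≤n+m k 2) 2+k≤2^t)) ⟩
      2 ^ (t * N) * 2 ^ (4 * m * K)    ≡⟨ ^-distribˡ-+-* 2 (t * N) (4 * m * K) ⟨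
      2 ^ (t * N + 4 * m * K)          ≤⟨ ^-monoʳ-≤ 2 exponent ⟩
      2 ^ (4 * N * K)                  ∎
      where
      K = k * 2 ^ k
      collect : ∀ b m K → b * (4 * K) + 4 * m * K ≡ 4 * (m + b) * K
      collect = solve-∀
      exponent : t * N + 4 * m * K ≤ 4 * N * K
      exponent = begin
        t * N + 4 * m * K                  ≤⟨ +-monoˡ-≤ (4 * m * K) (broken-log p t k-free 1≤l l≤n 2+k≤n least) ⟩
        B * #faces (2 + k) 1 + 4 * m * K   ≤⟨ +-monoˡ-≤ (4 * m * K) (*-monoʳ-≤ B (edges-bound 2≤k)) ⟩
        B * (4 * K) + 4 * m * K            ≡⟨ collect B m K ⟩
        4 * (m + B) * K                    ≡⟨ cong (λ x → 4 * x * K) (#intact+#broken l p) ⟩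
        4 * N * K                          ∎

theorem1 : ∃ λ (q : ℕ) → 1 ≤ q ×
    (∀ (k l : ℕ) → 2 ≤ l → l < k →
    ∃ λ (n₀ : ℕ) → ∀ (n : ℕ) → n₀ ≤ n →
    ∃ λ (N : ℕ) → ∃ λ (m : ℕ) →
    NumCopies l (Q n) N
    × IsEx n l k m
    × (k * N ≤ l * N + k * m)
    × (k * (k + 2) * N ≤ 4 * ((l + 2) C 3) * N + k * (k + 2) * m)
    × (k * 2 ^ k * m + l * 2 ^ l * N ≤ k * 2 ^ k * N)
    × (k ^ N * 2 ^ (q * m * (k * 2 ^ k)) ≤ 2 ^ (q * N * (k * 2 ^ k))))
-- The witness 4 is 1 / α for the binary logarithm. The threshold k + 2 makes room for the faces
-- examined in `log-bound`.
theorem1 = 4 , s≤s z≤n , λ k l 2≤l l<k → 2 + k , λ n 2+k≤n →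
  let 1≤l = ≤-trans (n≤1+n 1) 2≤l
      1≤k = ≤-trans 1≤l (<⇒≤ l<k)
      k≤n = ≤-trans (m≤n+m k 2) 2+k≤n
      l≤n = ≤-trans (<⇒≤ l<k) k≤n
      p , k-free , maximal = extremal n k l 1≤k
  in #faces n l , #intact l p , copies-in-Q n l 1≤l , extremal-IsEx p 1≤k 1≤l k-free maximal
   , DensityBounds.level-bound maximal 1≤k
   , DensityBounds.profile-bound maximal 1≤k
   , DensityBounds.local-bound p k-free 1≤k (<⇒≤ l<k) k≤n
   , DensityBounds.log-bound p k-free 1≤l (≤-trans 2≤l (<⇒≤ l<k)) l≤n 2+k≤n
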